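{- Let $\ell\in\mathbb{Z}_{\ge0}$ and let $\mathcal{C}$ denote the boundary complex of a $d$-dimensional $\ell$-fold capped cubical polytope. Then the $h$-polynomial $h(\mathrm{sd}(\mathcal{C});x)$ of the barycentric subdivision of $\mathcal{C}$ is real-rooted.
   Context: A cubical polytope is a (convex) polytope all of whose facets are combinatorial cubes. A polytope $P$ is capped over a cubical polytope $Q$ if there is a combinatorial cube $C$ (of the same dimension) such that $P=Q\cup C$ and $F:=Q\cap C$ is a facet of $Q$; combinatorially, the boundary complex of $P$ is obtained from that of $Q$ by subdividing the facet $F$ into the Schlegel diagram of a $d$-cube based at a facet identified with $F$. A polytope is $\ell$-fold capped cubical if it can be obtained from a combinatorial cube by $\ell$ capping operations. The boundary complex of a polytope is the polytopal complex of its proper faces (including $\emptyset$). The barycentric subdivision $\mathrm{sd}(\mathcal{C})$ of a polytopal complex $\mathcal{C}$ is the simplicial complex whose $k$-dimensional faces are the sets $\{F_0,\ldots,F_k\}$ of faces of $\mathcal{C}$ with $\emptyset\subsetneq F_0\subsetneq\cdots\subsetneq F_k$ (together with the empty face). For an $(m-1)$-dimensional complex $\mathcal{K}$, $f(\mathcal{K};x)=\sum_{k=-1}^{m-1}f_k(\mathcal{K})x^{k+1}$, where $f_k$ is the number of $k$-dimensional faces ($f_{ -1}=1$), and $h(\mathcal{K};x)=(1-x)^m f(\mathcal{K};\frac{x}{1-x})$. A real polynomial is real-rooted if it is identically zero or has only real zeros. -}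

module Defs where

open import Data.Fin.Subset using (Subset; ⊥; ⁅_⁆; _∈_; _⊆_; _⊂_; _∩_; Nonempty)
open import Data.Fin.Subset.Properties using (_⊂?_; nonempty?)
open import Data.Integer as ℤ using (ℤ; +_; -[1+_])
open import Data.List using (List; []; _∷_; map; foldr; filter; length; upTo; cartesianProductWith)
open import Data.List.Membership.Propositional renaming (_∈_ to _∈ˡ_)
open import Data.List.Relation.Unary.All using (All)
open import Data.List.Relation.Unary.Linked using (Linked; linked?)
open import Data.List.Relation.Unary.Unique.Propositional using (Unique)
open import Data.Nat as ℕ using (ℕ; zero; suc)
import Data.Nat.Properties as ℕ
open import Data.Product using (∃-syntax; Σ-syntax; _×_; _,_; proj₁; proj₂)
open import Data.Rational as ℚ using (ℚ; 0ℚ; 1ℚ; ½)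
import Data.Rational.Properties as ℚ
open import Data.Rational.Solver using (module +-*-Solver)
open import Data.Sum using (_⊎_)
open import Data.Vec using (Vec; replicate)
open import Data.Vec.Relation.Binary.Pointwise.Inductive using (Pointwise)
open import Function using (_on_; _⇔_)
open import Relation.Binary.Morphism.Structures using (IsOrderIsomorphism)
open import Relation.Binary.PropositionalEquality using (_≡_; _≢_; refl; sym; trans; cong; subst)

-- No modulus of convergence is fixed, so the ring operations are pointwise.

IsCauchy : (ℕ → ℚ) → Set
IsCauchy x = ∀ ε → 0ℚ ℚ.< ε →
             ∃[ n₀ ] ∀ m n → n₀ ℕ.≤ m → n₀ ℕ.≤ n → ℚ.∣ x m ℚ.- x n ∣ ℚ.< ε

record ℝ : Set where
  constructor mkℝ
  field
    seq    : ℕ → ℚ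
    cauchy : IsCauchy seq

open ℝ public

infix 4 _≈_

_≈_ : ℝ → ℝ → Set
x ≈ y = ∀ ε → 0ℚ ℚ.< ε → ∃[ n₀ ] ∀ n → n₀ ℕ.≤ n → ℚ.∣ seq x n ℚ.- seq y n ∣ ℚ.< ε

half+half : ∀ ε → ½ ℚ.* ε ℚ.+ ½ ℚ.* ε ≡ ε
half+half ε = trans (sym (ℚ.*-distribʳ-+ ε ½ ½)) (ℚ.*-identityˡ ε)

*-pos : ∀ {p q} → 0ℚ ℚ.< p → 0ℚ ℚ.< q → 0ℚ ℚ.< p ℚ.* q
*-pos {p} {q} 0<p 0<q =
  subst (ℚ._< p ℚ.* q) (ℚ.*-zeroʳ p)
    (ℚ.*-monoʳ-<-pos p ⦃ ℚ.positive 0<p ⦄ 0<q)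

*-mono-abs : ∀ {p q a b} → ℚ.∣ p ∣ ℚ.≤ a → ℚ.∣ q ∣ ℚ.≤ b → ℚ.∣ p ℚ.* q ∣ ℚ.≤ a ℚ.* b
*-mono-abs {p} {q} {a} {b} p≤a q≤b = begin
  ℚ.∣ p ℚ.* q ∣           ≡⟨ ℚ.∣p*q∣≡∣p∣*∣q∣ p q ⟩
  ℚ.∣ p ∣ ℚ.* ℚ.∣ q ∣     ≤⟨ ℚ.*-monoʳ-≤-nonNeg ℚ.∣ q ∣ ⦃ ℚ.nonNegative (ℚ.0≤∣p∣ q) ⦄ p≤a ⟩
  a ℚ.* ℚ.∣ q ∣           ≤⟨ ℚ.*-monoˡ-≤-nonNeg a ⦃ ℚ.nonNegative (ℚ.≤-trans (ℚ.0≤∣p∣ p) p≤a) ⦄ q≤b ⟩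
  a ℚ.* b                 ∎
  where open ℚ.≤-Reasoning

eventually-bounded : ∀ {x} → IsCauchy x →
  ∃[ b ] 0ℚ ℚ.< b × ∃[ n₀ ] ∀ n → n₀ ℕ.≤ n → ℚ.∣ x n ∣ ℚ.≤ b
eventually-bounded {x} cx with cx 1ℚ (ℚ.positive⁻¹ 1ℚ)
... | n₀ , close = 1ℚ ℚ.+ ℚ.∣ x n₀ ∣
                 , ℚ.+-mono-<-≤ (ℚ.positive⁻¹ 1ℚ) (ℚ.0≤∣p∣ (x n₀))
                 , n₀ , λ n n₀≤n → begin
  ℚ.∣ x n ∣                              ≡⟨ cong ℚ.∣_∣ (split (x n) (x n₀)) ⟩
  ℚ.∣ (x n ℚ.- x n₀) ℚ.+ x n₀ ∣          ≤⟨ ℚ.∣p+q∣≤∣p∣+∣q∣ (x n ℚ.- x n₀) (x n₀) ⟩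
  ℚ.∣ x n ℚ.- x n₀ ∣ ℚ.+ ℚ.∣ x n₀ ∣      ≤⟨ ℚ.+-monoˡ-≤ ℚ.∣ x n₀ ∣ (ℚ.<⇒≤ (close n n₀ n₀≤n ℕ.≤-refl)) ⟩
  1ℚ ℚ.+ ℚ.∣ x n₀ ∣                      ∎
  where
  open ℚ.≤-Reasoning
  open +-*-Solver
  split : ∀ p q → p ≡ (p ℚ.- q) ℚ.+ q
  split = solve 2 (λ p q → p := (p :- q) :+ q) refl

const-cauchy : ∀ q → IsCauchy (λ _ → q)
const-cauchy q ε 0<ε =
  0 , λ _ _ _ _ → subst (ℚ._< ε) (sym (cong ℚ.∣_∣ (ℚ.+-inverseʳ q))) 0<ε

+-cauchy : ∀ x y → IsCauchy x → IsCauchy y → IsCauchy (λ n → x n ℚ.+ y n)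
+-cauchy x y cx cy ε 0<ε
  with cx (½ ℚ.* ε) (*-pos (ℚ.positive⁻¹ ½) 0<ε) | cy (½ ℚ.* ε) (*-pos (ℚ.positive⁻¹ ½) 0<ε)
... | i , close-x | j , close-y = i ℕ.⊔ j , λ m n k≤m k≤n → begin-strict
  ℚ.∣ (x m ℚ.+ y m) ℚ.- (x n ℚ.+ y n) ∣
    ≡⟨ cong ℚ.∣_∣ (regroup (x m) (y m) (x n) (y n)) ⟩
  ℚ.∣ (x m ℚ.- x n) ℚ.+ (y m ℚ.- y n) ∣
    ≤⟨ ℚ.∣p+q∣≤∣p∣+∣q∣ (x m ℚ.- x n) (y m ℚ.- y n) ⟩
  ℚ.∣ x m ℚ.- x n ∣ ℚ.+ ℚ.∣ y m ℚ.- y n ∣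
    <⟨ ℚ.+-mono-< (close-x m n (ℕ.m⊔n≤o⇒m≤o i j k≤m) (ℕ.m⊔n≤o⇒m≤o i j k≤n))
                  (close-y m n (ℕ.m⊔n≤o⇒n≤o i j k≤m) (ℕ.m⊔n≤o⇒n≤o i j k≤n)) ⟩
  ½ ℚ.* ε ℚ.+ ½ ℚ.* ε
    ≡⟨ half+half ε ⟩
  ε ∎
  where
  open ℚ.≤-Reasoning
  open +-*-Solver
  regroup : ∀ a b c d → (a ℚ.+ b) ℚ.- (c ℚ.+ d) ≡ (a ℚ.- c) ℚ.+ (b ℚ.- d)
  regroup = solve 4 (λ a b c d → (a :+ b) :- (c :+ d) := (a :- c) :+ (b :- d)) refl

neg-cauchy : ∀ x → IsCauchy x → IsCauchy (λ n → ℚ.- x n)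
neg-cauchy x cx ε 0<ε with cx ε 0<ε
... | i , close = i , λ m n i≤m i≤n →
  subst (ℚ._< ε)
    (trans (sym (ℚ.∣-p∣≡∣p∣ (x m ℚ.- x n))) (cong ℚ.∣_∣ (ℚ.neg-distrib-+ (x m) (ℚ.- x n))))
    (close m n i≤m i≤n)

shrink : ∀ {c ε} → 0ℚ ℚ.< c → 0ℚ ℚ.< ε → ∃[ δ ] 0ℚ ℚ.< δ × c ℚ.* δ ℚ.≤ ε
shrink {c} {ε} 0<c 0<ε =
    (ℚ.1/ c) ℚ.* ε
  , *-pos (ℚ.positive⁻¹ (ℚ.1/ c) ⦃ ℚ.1/pos⇒pos c ⦄) 0<ε
  , ℚ.≤-reflexive (trans (sym (ℚ.*-assoc c (ℚ.1/ c) ε))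
                  (trans (cong (ℚ._* ε) (ℚ.*-inverseʳ c)) (ℚ.*-identityˡ ε)))
  where
  instance
    c-pos : ℚ.Positive c
    c-pos = ℚ.positive 0<c
    c≢0 : ℚ.NonZero c
    c≢0 = ℚ.pos⇒nonZero c

*-close : ∀ {a b δ} p q r s → ℚ.∣ r ∣ ℚ.≤ a → ℚ.∣ q ∣ ℚ.≤ b →
          ℚ.∣ p ℚ.- r ∣ ℚ.≤ δ → ℚ.∣ q ℚ.- s ∣ ℚ.≤ δ →
          ℚ.∣ p ℚ.* q ℚ.- r ℚ.* s ∣ ℚ.≤ (a ℚ.+ b) ℚ.* δ
*-close {a} {b} {δ} p q r s r≤a q≤b pr≤δ qs≤δ = begin
  ℚ.∣ p ℚ.* q ℚ.- r ℚ.* s ∣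
    ≡⟨ cong ℚ.∣_∣ (regroup p q r s) ⟩
  ℚ.∣ r ℚ.* (q ℚ.- s) ℚ.+ (p ℚ.- r) ℚ.* q ∣
    ≤⟨ ℚ.∣p+q∣≤∣p∣+∣q∣ (r ℚ.* (q ℚ.- s)) ((p ℚ.- r) ℚ.* q) ⟩
  ℚ.∣ r ℚ.* (q ℚ.- s) ∣ ℚ.+ ℚ.∣ (p ℚ.- r) ℚ.* q ∣
    ≤⟨ ℚ.+-mono-≤ (*-mono-abs {r} {q ℚ.- s} r≤a qs≤δ) (*-mono-abs {p ℚ.- r} {q} pr≤δ q≤b) ⟩
  a ℚ.* δ ℚ.+ δ ℚ.* b
    ≡⟨ collect a b δ ⟩
  (a ℚ.+ b) ℚ.* δ ∎
  where
  open ℚ.≤-Reasoning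
  open +-*-Solver
  regroup : ∀ p q r s → p ℚ.* q ℚ.- r ℚ.* s ≡ r ℚ.* (q ℚ.- s) ℚ.+ (p ℚ.- r) ℚ.* q
  regroup = solve 4 (λ p q r s → p :* q :- r :* s := r :* (q :- s) :+ (p :- r) :* q) refl
  collect : ∀ p q r → p ℚ.* r ℚ.+ r ℚ.* q ≡ (p ℚ.+ q) ℚ.* r
  collect = solve 3 (λ p q r → p :* r :+ r :* q := (p :+ q) :* r) refl

half< : ∀ {ε} → 0ℚ ℚ.< ε → ½ ℚ.* ε ℚ.< ε
half< {ε} 0<ε = subst (½ ℚ.* ε ℚ.<_) (ℚ.*-identityˡ ε)
                  (ℚ.*-monoˡ-<-pos ε ⦃ ℚ.positive 0<ε ⦄ {½} {1ℚ} (ℚ.*<* (ℤ.+<+ (ℕ.s≤s (ℕ.s≤s ℕ.z≤n)))))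

*-cauchy : ∀ x y → IsCauchy x → IsCauchy y → IsCauchy (λ n → x n ℚ.* y n)
*-cauchy x y cx cy ε 0<ε =
  let a , 0<a , k , bound-x = eventually-bounded cx
      b , 0<b , l , bound-y = eventually-bounded cy
      δ , 0<δ , cδ≤½ε = shrink (ℚ.+-mono-< 0<a 0<b) (*-pos (ℚ.positive⁻¹ ½) 0<ε)
      i , close-x = cx δ 0<δ
      j , close-y = cy δ 0<δ
      left : ∀ {n} → (k ℕ.⊔ l) ℕ.⊔ (i ℕ.⊔ j) ℕ.≤ n → k ℕ.⊔ l ℕ.≤ n
      left = ℕ.m⊔n≤o⇒m≤o (k ℕ.⊔ l) (i ℕ.⊔ j)
      right : ∀ {n} → (k ℕ.⊔ l) ℕ.⊔ (i ℕ.⊔ j) ℕ.≤ n → i ℕ.⊔ j ℕ.≤ n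
      right = ℕ.m⊔n≤o⇒n≤o (k ℕ.⊔ l) (i ℕ.⊔ j)
  in (k ℕ.⊔ l) ℕ.⊔ (i ℕ.⊔ j) , λ m n N≤m N≤n →
    ℚ.≤-<-trans
      (ℚ.≤-trans
        (*-close (x m) (y m) (x n) (y n)
          (bound-x n (ℕ.m⊔n≤o⇒m≤o k l (left N≤n)))
          (bound-y m (ℕ.m⊔n≤o⇒n≤o k l (left N≤m)))
          (ℚ.<⇒≤ (close-x m n (ℕ.m⊔n≤o⇒m≤o i j (right N≤m)) (ℕ.m⊔n≤o⇒m≤o i j (right N≤n))))
          (ℚ.<⇒≤ (close-y m n (ℕ.m⊔n≤o⇒n≤o i j (right N≤m)) (ℕ.m⊔n≤o⇒n≤o i j (right N≤n)))))
        cδ≤½ε)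
      (half< 0<ε)

infixl 6 _+ᵣ_ _-ᵣ_
infixl 7 _*ᵣ_

_+ᵣ_ _-ᵣ_ _*ᵣ_ : ℝ → ℝ → ℝ
x +ᵣ y = mkℝ (λ n → seq x n ℚ.+ seq y n) (+-cauchy (seq x) (seq y) (cauchy x) (cauchy y))
x -ᵣ y = mkℝ (λ n → seq x n ℚ.- seq y n) (+-cauchy (seq x) (λ n → ℚ.- seq y n) (cauchy x) (neg-cauchy (seq y) (cauchy y)))
x *ᵣ y = mkℝ (λ n → seq x n ℚ.* seq y n) (*-cauchy (seq x) (seq y) (cauchy x) (cauchy y))

fromℤ : ℤ → ℝ
fromℤ i = mkℝ (λ _ → i ℚ./ 1) (const-cauchy (i ℚ./ 1))

0ᵣ : ℝ
0ᵣ = fromℤ (+ 0)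

record ℂ : Set where
  constructor _+i_
  field
    re im : ℝ

open ℂ public

infix  4 _≈ᶜ_
infixl 6 _+ᶜ_
infixl 7 _*ᶜ_

_≈ᶜ_ : ℂ → ℂ → Set
z ≈ᶜ w = re z ≈ re w × im z ≈ im w

_+ᶜ_ _*ᶜ_ : ℂ → ℂ → ℂ
z +ᶜ w = (re z +ᵣ re w) +i (im z +ᵣ im w)
z *ᶜ w = (re z *ᵣ re w -ᵣ im z *ᵣ im w) +i (re z *ᵣ im w +ᵣ im z *ᵣ re w)

fromℝ : ℝ → ℂ
fromℝ x = x +i 0ᵣ

-- Polynomials are coefficient lists, constant term first; trailing zeros
-- are allowed.

Poly : Set → Set
Poly A = List A

eval : Poly ℝ → ℂ → ℂ
eval []      z = fromℝ 0ᵣ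
eval (a ∷ p) z = fromℝ a +ᶜ z *ᶜ eval p z

RealRooted : Poly ℝ → Set
RealRooted p = All (_≈ 0ᵣ) p ⊎ (∀ z → eval p z ≈ᶜ fromℝ 0ᵣ → im z ≈ 0ᵣ)

toRealPoly : Poly ℤ → Poly ℝ
toRealPoly = map fromℤ

infixl 6 _⊕_
infixl 7 _⊛_
infixr 8 _^ₚ_

_⊕_ : Poly ℤ → Poly ℤ → Poly ℤ
[]      ⊕ q       = q
(a ∷ p) ⊕ []      = a ∷ p
(a ∷ p) ⊕ (b ∷ q) = (a ℤ.+ b) ∷ (p ⊕ q)

_⊛_ : Poly ℤ → Poly ℤ → Poly ℤ
[]      ⊛ q = []
(a ∷ p) ⊛ q = map (a ℤ.*_) q ⊕ (+ 0 ∷ (p ⊛ q))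

constant : ℤ → Poly ℤ
constant a = a ∷ []

X : Poly ℤ
X = + 0 ∷ + 1 ∷ []

1-X : Poly ℤ
1-X = + 1 ∷ -[1+ 0 ] ∷ []

_^ₚ_ : Poly ℤ → ℕ → Poly ℤ
p ^ₚ zero  = constant (+ 1)
p ^ₚ suc n = p ⊛ p ^ₚ n

-- (1 - x)^m f(x / (1 - x)) with f(x) = Σ_{j ≤ m} φ j x^j and the denominators
-- cleared.  Indices are shifted by one: φ j is the number of
-- (j - 1)-dimensional faces of a complex of dimension m - 1.

h : ℕ → (ℕ → ℕ) → Poly ℤ
h m φ = foldr _⊕_ [] (map (λ j → constant (+ φ j) ⊛ (X ^ₚ j ⊛ 1-X ^ₚ (m ℕ.∸ j))) (upTo (suc m)))

-- Polytopal complexes, recorded by the vertex sets of their faces.  The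
-- ambient set Fin N may contain points that are not vertices, so that
-- different complexes can share vertices.

record PolytopalComplex (N : ℕ) : Set where
  field
    faces         : List (Subset N)
    unique        : Unique faces
    empty-face    : ⊥ ∈ˡ faces
    vertex-face   : ∀ {v G} → v ∈ G → G ∈ˡ faces → ⁅ v ⁆ ∈ˡ faces
    intersections : ∀ {G H} → G ∈ˡ faces → H ∈ˡ faces → G ∩ H ∈ˡ faces

open PolytopalComplex public

infix 4 _∈ᶠ_

_∈ᶠ_ : ∀ {N} → Subset N → PolytopalComplex N → Set
G ∈ᶠ 𝒦 = G ∈ˡ faces 𝒦

IsFacet : ∀ {N} → PolytopalComplex N → Subset N → Set
IsFacet 𝒦 F = F ∈ᶠ 𝒦 × (∀ {G} → G ∈ᶠ 𝒦 → F ⊆ G → G ≡ F)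

-- The nonempty faces {0}, {1} and [0,1] of the unit interval.
data IntervalFace : Set where
  lo hi whole : IntervalFace

data _≤ᴵ_ : IntervalFace → IntervalFace → Set where
  ≤same  : ∀ {a} → a ≤ᴵ a
  ≤whole : ∀ {a} → a ≤ᴵ whole

-- The nonempty faces of [0,1]^d are the products of d such faces.
data CubeFace (d : ℕ) : Set where
  empty : CubeFace d
  prod  : Vec IntervalFace d → CubeFace d

data _≤ᶜ_ {d : ℕ} : CubeFace d → CubeFace d → Set where
  empty≤ : ∀ {G} → empty ≤ᶜ G
  prod≤  : ∀ {u v} → Pointwise _≤ᴵ_ u v → prod u ≤ᶜ prod v

ProperCubeFace : ℕ → Set
ProperCubeFace d = Σ[ G ∈ CubeFace d ] G ≢ prod (replicate d whole)

FaceOf : ∀ {N} → PolytopalComplex N → Set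
FaceOf 𝒦 = ∃[ G ] G ∈ᶠ 𝒦

-- 𝒦 is the boundary complex of a combinatorial d-cube: its face poset is
-- isomorphic to the poset of proper faces of [0,1]^d.
IsCubeBoundary : ∀ {N} → ℕ → PolytopalComplex N → Set
IsCubeBoundary d 𝒦 =
  Σ[ ϕ ∈ (ProperCubeFace d → FaceOf 𝒦) ]
    IsOrderIsomorphism (_≡_ on proj₁) (_≡_ on proj₁) (_≤ᶜ_ on proj₁) (_⊆_ on proj₁) ϕ

-- 𝒫, 𝒬 and 𝒞 are the boundary complexes of P, Q and C with P = Q ∪ C and
-- Q ∩ C = F.  The complex 𝒞 without F is the Schlegel diagram of C based at
-- F, and it replaces the facet F of 𝒬.
record IsCapping {N : ℕ} (d : ℕ) (𝒬 𝒫 : PolytopalComplex N) : Set where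
  field
    𝒞       : PolytopalComplex N
    F       : Subset N
    cube    : IsCubeBoundary d 𝒞
    facet-𝒬 : IsFacet 𝒬 F
    facet-𝒞 : IsFacet 𝒞 F
    meet-𝒬  : ∀ G → (G ∈ᶠ 𝒬 × G ∈ᶠ 𝒞) ⇔ (G ∈ᶠ 𝒬 × G ⊆ F)
    meet-𝒞  : ∀ G → (G ∈ᶠ 𝒬 × G ∈ᶠ 𝒞) ⇔ (G ∈ᶠ 𝒞 × G ⊆ F)
    union   : ∀ G → G ∈ᶠ 𝒫 ⇔ ((G ∈ᶠ 𝒬 ⊎ G ∈ᶠ 𝒞) × G ≢ F)

-- CappedCubical d ℓ 𝒫: 𝒫 is the boundary complex of a d-dimensional ℓ-fold
-- capped cubical polytope.
data CappedCubical {N : ℕ} (d : ℕ) : ℕ → PolytopalComplex N → Set where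
  cube : ∀ {𝒫} → IsCubeBoundary d 𝒫 → CappedCubical d 0 𝒫
  cap  : ∀ {ℓ 𝒬 𝒫} → CappedCubical d ℓ 𝒬 → IsCapping d 𝒬 𝒫 → CappedCubical d (suc ℓ) 𝒫

tuples : ∀ {A : Set} → ℕ → List A → List (List A)
tuples zero    xs = [] ∷ []
tuples (suc j) xs = cartesianProductWith _∷_ xs (tuples j xs)

-- sd 𝒦 j lists the (j - 1)-dimensional faces {F₁ , … , Fⱼ} of the subdivision,
-- each one once, as its increasing enumeration F₁ ⊂ ⋯ ⊂ Fⱼ.
sd : ∀ {N} → PolytopalComplex N → ℕ → List (List (Subset N))
sd 𝒦 j = filter (linked? _⊂?_) (tuples j (filter nonempty? (faces 𝒦)))

f-vector : ∀ {A : Set} → (ℕ → List A) → ℕ → ℕ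
f-vector facesOfSize j = length (facesOfSize j)

{-# OPTIONS --safe #-}

-- Write B_d for the h-polynomial of the subdivided boundary of the d-cube (the Eulerian
-- polynomial of type B).  Gluing on a cube along a facet changes the f-polynomial by
-- f(∂C_d) - (2x + 1) f(∂C_{d-1}), so an ℓ-fold capped polytope has
-- h = (ℓ + 1) B_d - ℓ (1 + x) B_{d-1} = (1 + x) B_{d-1} + (ℓ + 1) T, where
-- T = B_d - (1 + x) B_{d-1}.
--
-- No root is ever located.  Fix z in ℚ(i) with imaginary part y.  The values at z of the
-- numerators of Σ_m (2m)^(d-i) (2m+1)^i x^m and Σ_m (2m+1)^(d-i) (2m+2)^i x^m form a
-- sequence whose arguments vary monotonically by at most arg z, and this is preserved by
-- the recursion from d to d + 1.  It gives y Im(T B̄_{d-1}) ≥ 0, hence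
-- |h(z)| ≥ |y| |B_{d-1}(z)|, and inductively |h(z)|² ≥ (y²)^d.  This bound at the rational
-- approximations of a complex zero forces its imaginary part to vanish.

module Submission where

open import Defs
open import Algebra.Bundles using (CommutativeSemiring)
import Algebra.Definitions.RawSemiring as RawSemiringOps
import Algebra.Properties.Group as Group
import Algebra.Properties.Monoid.Mult as Mult
import Algebra.Solver.Ring.NaturalCoefficients.Default as NaturalCoefficients
open import Algebra.Structures using (IsCommutativeSemiring)
open import Algebra.Structures.Biased using (isCommutativeMonoidˡ; isCommutativeSemiringˡ)
open import Data.Bool using (true; false)
import Data.Bool.Properties as Bool
open import Data.Empty using (⊥-elim)
open import Data.Fin.Properties using (any?)
open import Data.Fin.Subset using (Subset; ⊥; _∈_; _⊆_; _⊂_; Nonempty)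
open import Data.Fin.Subset.Properties using (_⊂?_; _∈?_; nonempty?; ∉⊥; ⊥⊆; ⊆-antisym; ⊆-refl; ⊂-irref;
  Empty-unique; x∈⁅x⁆)
open import Data.Integer as ℤ using (ℤ; -[1+_]) renaming (+_ to pos)
import Data.Integer.Properties as ℤ
open import Data.List using (List; []; _∷_; _++_; map; filter; foldr; length; applyUpTo; cartesianProductWith)
import Data.List.Membership.DecPropositional as DecMembership
open import Data.List.Membership.Propositional using () renaming (_∈_ to _∈ˡ_)
open import Data.List.Membership.Propositional.Properties using
  (∈-filter⁺; ∈-filter⁻; ∈-map⁺; ∈-map⁻; ∈-++⁺ˡ; ∈-++⁺ʳ; ∈-++⁻)
open import Data.List.Membership.Propositional.Properties.WithK using (unique∧set⇒bag)
open import Data.List.Properties using (map-++; map-cong-local; filter-++; length-++; map-∘)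
open import Data.List.Relation.Binary.BagAndSetEquality using (∼bag⇒↭)
open import Data.List.Relation.Binary.Permutation.Propositional using (_↭_)
import Data.List.Relation.Binary.Permutation.Propositional.Properties as ↭
import Data.List.Relation.Unary.All as All
import Data.List.Relation.Unary.All.Properties as All using (map⁺)
open import Data.List.Relation.Unary.AllPairs using ([]; _∷_)
open import Data.List.Relation.Unary.Any using (here; there)
open import Data.List.Relation.Unary.Linked using (linked?)
open import Data.List.Relation.Unary.Unique.Propositional using (Unique)
import Data.List.Relation.Unary.Unique.Propositional.Properties as Unique
open import Data.Nat as ℕ using (ℕ; zero; suc; _∸_; _<_; _≤_; s≤s; z≤n)
open import Data.Nat.ListAction using (sum)
open import Data.Nat.ListAction.Properties using (sum-++; sum-↭)
import Data.Nat.Properties as ℕ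
import Data.Nat.Solver as ℕ
open import Data.Product using (∃; _×_; _,_; proj₁; proj₂)
open import Data.Rational as ℚ using (ℚ; 0ℚ; 1ℚ; ½)
import Data.Rational.Properties as ℚ
import Data.Rational.Solver as ℚ
open import Data.Rational.Unnormalised as ℚᵘ using (mkℚᵘ; *≡*)
import Data.Rational.Unnormalised.Properties as ℚᵘ
open import Data.Sum using (_⊎_; inj₁; inj₂; [_,_]′)
open import Data.Vec using (Vec; []; _∷_; replicate)
open import Data.Vec.Properties using (∷-injective; ≡-dec)
open import Data.Vec.Relation.Binary.Pointwise.Inductive as PW using (Pointwise; []; _∷_)
open import Function using (_∘_; case_of_; mk⇔; Equivalence)
open import Relation.Binary using (Decidable; DecidableEquality; tri<; tri≈; tri>)
open import Relation.Binary.Morphism.Structures using (IsOrderIsomorphism)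
open import Relation.Binary.PropositionalEquality using (_≡_; _≢_; _≗_; refl; sym; trans; cong; cong₂;
  subst; subst₂; isEquivalence; module ≡-Reasoning)
open import Relation.Nullary using (¬_; Dec; yes; no; does; contradiction)
open import Relation.Nullary.Decidable using (_×-dec_; ¬?)
import Relation.Unary as U


-- Since `Σ_m C(m, j) x^m = x^j / (1 - x)^(j+1)`, passing from `f` to `h` sends a coefficient
-- sequence `φ` to the numerator of `Σ_m p(m) x^m` with `p(m) = Σ_j φ j C(m, j)`. For the chains of
-- faces of the d-cube `p(m) = (2m+1)^d`. That is why `B_d` belongs to the family, and it occurs
-- twice: last in the first half and first in the second half. In the recursion these two copies get
-- the weights 1 and `x`, so the term `(1 + x) B_{d-1}` that capping brings in is exactly what the
-- recursion splits off `B_d`, and `T` gathers all other members.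
--
-- Arguments are replaced by signs of the form `y Im(a b̄)`. The factor `y` treats both half-planes
-- at once, and zero values satisfy every inequality, so no member of the family has to be shown
-- nonzero.
--
-- A real is a Cauchy sequence with pointwise operations, so each term of a value is exactly the
-- value at a point of `ℚ(i)`. Nonvanishing at these points would say nothing about the limit; a
-- lower bound depending only on `y` and `d` does.

module ChainCounts where

  open import Data.Nat using (_+_; _*_)

  -- Finite sums and the counting of chains.

  sumOver : ∀ {A : Set} → List A → (A → ℕ) → ℕ
  sumOver xs f = sum (map f xs)

  sumOver-cong : ∀ {A : Set} (xs : List A) {f g : A → ℕ} →
                 (∀ {x} → x ∈ˡ xs → f x ≡ g x) → sumOver xs f ≡ sumOver xs g
  sumOver-cong xs f≗g = cong sum (map-cong-local (All.tabulate f≗g))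

  sumOver-↭ : ∀ {A : Set} {xs ys : List A} (f : A → ℕ) → xs ↭ ys → sumOver xs f ≡ sumOver ys f
  sumOver-↭ f p = sum-↭ (↭.map⁺ f p)

  sumOver-++ : ∀ {A : Set} (xs ys : List A) (f : A → ℕ) →
               sumOver (xs ++ ys) f ≡ sumOver xs f + sumOver ys f
  sumOver-++ xs ys f = trans (cong sum (map-++ f xs ys)) (sum-++ (map f xs) (map f ys))

  sumOver-map : ∀ {A B : Set} (h : A → B) (xs : List A) (f : B → ℕ) →
                sumOver (map h xs) f ≡ sumOver xs (f ∘ h)
  sumOver-map h xs f = cong sum (sym (map-∘ xs))

  sumOver-zero : ∀ {A : Set} (xs : List A) → sumOver xs (λ _ → 0) ≡ 0
  sumOver-zero []       = refl
  sumOver-zero (_ ∷ xs) = sumOver-zero xs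

  sumOver-+ : ∀ {A : Set} (xs : List A) (f g : A → ℕ) →
              sumOver xs (λ x → f x + g x) ≡ sumOver xs f + sumOver xs g
  sumOver-+ []       f g = refl
  sumOver-+ (x ∷ xs) f g rewrite sumOver-+ xs f g =
    solve 4 (λ a b s t → a :+ b :+ (s :+ t) := a :+ s :+ (b :+ t)) refl
      (f x) (g x) (sumOver xs f) (sumOver xs g)
    where open ℕ.+-*-Solver

  sumOver-* : ∀ {A : Set} (k : ℕ) (xs : List A) (f : A → ℕ) →
              sumOver xs (λ x → k * f x) ≡ k * sumOver xs f
  sumOver-* k []       f = sym (ℕ.*-zeroʳ k)
  sumOver-* k (x ∷ xs) f rewrite sumOver-* k xs f = sym (ℕ.*-distribˡ-+ k (f x) (sumOver xs f))

  sumOver-swap : ∀ {A B : Set} (xs : List A) (ys : List B) (f : A → B → ℕ) →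
                 sumOver xs (λ x → sumOver ys (f x)) ≡ sumOver ys (λ y → sumOver xs (λ x → f x y))
  sumOver-swap []       ys f = sym (sumOver-zero ys)
  sumOver-swap (x ∷ xs) ys f rewrite sumOver-swap xs ys f =
    sym (sumOver-+ ys (f x) (λ y → sumOver xs (λ x → f x y)))

  -- The filtered singleton acts as the indicator of `P x`. A filtered inner sum thus becomes a sum
  -- over the full list, which can be exchanged with an outer sum.
  sumOver-filter-* : ∀ {A : Set} {P : A → Set} (P? : U.Decidable P) (k : ℕ) (xs : List A) (f : A → ℕ) →
    k * sumOver (filter P? xs) f ≡ sumOver xs (λ x → sumOver (filter P? (x ∷ [])) (λ x → k * f x))
  sumOver-filter-* P? k []       f = ℕ.*-zeroʳ k
  sumOver-filter-* P? k (x ∷ xs) f with does (P? x)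
  ... | true  = trans (ℕ.*-distribˡ-+ k (f x) _)
                  (cong₂ _+_ (sym (ℕ.+-identityʳ (k * f x))) (sumOver-filter-* P? k xs f))
  ... | false = sumOver-filter-* P? k xs f

  unique-↭ : ∀ {A : Set} {xs ys : List A} → Unique xs → Unique ys →
             (∀ {x} → x ∈ˡ xs → x ∈ˡ ys) → (∀ {x} → x ∈ˡ ys → x ∈ˡ xs) → xs ↭ ys
  unique-↭ xs! ys! to from = ∼bag⇒↭ (unique∧set⇒bag xs! ys! (mk⇔ to from))

  module _ {A : Set} {R : A → A → Set} (R? : Decidable R) where

    -- `tuples` builds a chain from its least element, which leads to `chainsAbove`. The geometry
    -- needs `chainsBelow`: gluing changes what lies above a surviving face, but not what lies below
    -- it.
    chainsAbove chainsBelow : List A → ℕ → A → ℕ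
    chainsAbove xs zero    x = 1
    chainsAbove xs (suc j) x = sumOver (filter (R? x) xs) (chainsAbove xs j)
    chainsBelow xs zero    x = 1
    chainsBelow xs (suc j) x = sumOver (filter (λ y → R? y x) xs) (chainsBelow xs j)

    private
      links : List (List A) → ℕ
      links ts = length (filter (linked? R?) ts)

      links-++ : ∀ ss ts → links (ss ++ ts) ≡ links ss + links ts
      links-++ ss ts = trans (cong length (filter-++ (linked? R?) ss ts))
                             (length-++ (filter (linked? R?) ss))

    links-∷∷ : ∀ x y (ts : List (List A)) →
               length (filter (linked? R?) (map (x ∷_) (map (y ∷_) ts)))
               ≡ sumOver (filter (R? x) (y ∷ [])) (λ y → length (filter (linked? R?) (map (y ∷_) ts)))
    links-∷∷ x y [] with does (R? x y)
    ... | true  = refl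
    ... | false = refl
    links-∷∷ x y (t ∷ ts) with does (R? x y) | links-∷∷ x y ts
    ... | false | ih = ih
    ... | true  | ih with does (linked? R? (y ∷ t))
    ...   | true  = cong suc ih
    ...   | false = ih

    links-∷ : ∀ (xs ys : List A) j x →
              (∀ y → links (map (y ∷_) (tuples j xs)) ≡ chainsAbove xs j y) →
              links (map (x ∷_) (cartesianProductWith _∷_ ys (tuples j xs)))
              ≡ sumOver (filter (R? x) ys) (chainsAbove xs j)
    links-∷ xs []       j x ih = refl
    links-∷ xs (y ∷ ys) j x ih = begin
      links (map (x ∷_) (map (y ∷_) ts ++ cartesianProductWith _∷_ ys ts))
        ≡⟨ cong links (map-++ (x ∷_) (map (y ∷_) ts) _) ⟩
      links (map (x ∷_) (map (y ∷_) ts) ++ map (x ∷_) (cartesianProductWith _∷_ ys ts))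
        ≡⟨ links-++ (map (x ∷_) (map (y ∷_) ts)) _ ⟩
      links (map (x ∷_) (map (y ∷_) ts)) + links (map (x ∷_) (cartesianProductWith _∷_ ys ts))
        ≡⟨ cong₂ _+_ (trans (links-∷∷ x y ts) (sumOver-cong (filter (R? x) (y ∷ [])) (λ {y} _ → ih y)))
                     (links-∷ xs ys j x ih) ⟩
      sumOver (filter (R? x) (y ∷ [])) (chainsAbove xs j) + sumOver (filter (R? x) ys) (chainsAbove xs j)
        ≡⟨ sumOver-++ (filter (R? x) (y ∷ [])) (filter (R? x) ys) _ ⟨
      sumOver (filter (R? x) (y ∷ []) ++ filter (R? x) ys) (chainsAbove xs j)
        ≡⟨ cong (λ l → sumOver l (chainsAbove xs j)) (filter-++ (R? x) (y ∷ []) ys) ⟨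
      sumOver (filter (R? x) (y ∷ ys)) (chainsAbove xs j) ∎
      where
      open ≡-Reasoning
      ts : List (List A)
      ts = tuples j xs

    length-chains-∷ : ∀ (xs : List A) j x →
      length (filter (linked? R?) (map (x ∷_) (tuples j xs))) ≡ chainsAbove xs j x
    length-chains-∷ xs zero    x = refl
    length-chains-∷ xs (suc j) x = links-∷ xs xs j x (length-chains-∷ xs j)

    length-chains-above : ∀ (xs : List A) j →
      length (filter (linked? R?) (tuples (suc j) xs)) ≡ sumOver xs (chainsAbove xs j)
    length-chains-above xs j = go xs
      where
      go : ∀ ys → links (cartesianProductWith _∷_ ys (tuples j xs)) ≡ sumOver ys (chainsAbove xs j)
      go []       = refl
      go (y ∷ ys) = trans (links-++ (map (y ∷_) (tuples j xs)) _)
                          (cong₂ _+_ (length-chains-∷ xs j y) (go ys))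

    -- Double counting by the position at which a chain is cut.
    chains-shift : ∀ (xs : List A) i j →
      sumOver xs (λ x → chainsBelow xs i x * chainsAbove xs (suc j) x)
      ≡ sumOver xs (λ y → chainsBelow xs (suc i) y * chainsAbove xs j y)
    chains-shift xs i j = begin
      sumOver xs (λ x → b x * sumOver (filter (R? x) xs) a)
        ≡⟨ sumOver-cong xs (λ {x} _ → sumOver-filter-* (R? x) (b x) xs a) ⟩
      sumOver xs (λ x → sumOver xs (λ y → sumOver (filter (R? x) (y ∷ [])) (λ y → b x * a y)))
        ≡⟨ sumOver-swap xs xs _ ⟩
      sumOver xs (λ y → sumOver xs (λ x → sumOver (filter (R? x) (y ∷ [])) (λ y → b x * a y)))
        ≡⟨ sumOver-cong xs (λ {y} _ → sumOver-cong xs (λ {x} _ → flip-singleton x y)) ⟩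
      sumOver xs (λ y → sumOver xs (λ x → sumOver (filter (λ x → R? x y) (x ∷ [])) (λ x → a y * b x)))
        ≡⟨ sumOver-cong xs (λ {y} _ → sym (sumOver-filter-* (λ x → R? x y) (a y) xs b)) ⟩
      sumOver xs (λ y → a y * chainsBelow xs (suc i) y)
        ≡⟨ sumOver-cong xs (λ {y} _ → ℕ.*-comm (a y) (chainsBelow xs (suc i) y)) ⟩
      sumOver xs (λ y → chainsBelow xs (suc i) y * a y) ∎
      where
      open ≡-Reasoning
      a b : A → ℕ
      a = chainsAbove xs j
      b = chainsBelow xs i
      flip-singleton : ∀ x y → sumOver (filter (R? x) (y ∷ [])) (λ y → b x * a y)
                             ≡ sumOver (filter (λ x → R? x y) (x ∷ [])) (λ x → a y * b x)
      flip-singleton x y with does (R? x y)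
      ... | true  = cong (_+ 0) (ℕ.*-comm (b x) (a y))
      ... | false = refl

    -- Each side counts linked sequences of `i + j + 1` entries, by the entry in position `i + 1`
    -- and by the last one. The cut moves up one entry at a time.
    chains-cut : ∀ (xs : List A) i j →
      sumOver xs (λ x → chainsBelow xs i x * chainsAbove xs j x) ≡ sumOver xs (chainsBelow xs (j + i))
    chains-cut xs i zero    = sumOver-cong xs (λ _ → ℕ.*-identityʳ _)
    chains-cut xs i (suc j) = trans (chains-shift xs i j)
      (trans (chains-cut xs (suc i) j) (cong (λ k → sumOver xs (chainsBelow xs k)) (ℕ.+-suc j i)))

    length-chains : ∀ (xs : List A) j →
      length (filter (linked? R?) (tuples (suc j) xs)) ≡ sumOver xs (chainsBelow xs j)
    length-chains xs j = begin
      length (filter (linked? R?) (tuples (suc j) xs)) ≡⟨ length-chains-above xs j ⟩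
      sumOver xs (chainsAbove xs j)                    ≡⟨ sumOver-cong xs (λ _ → sym (ℕ.*-identityˡ _)) ⟩
      sumOver xs (λ x → 1 * chainsAbove xs j x)        ≡⟨ chains-cut xs 0 j ⟩
      sumOver xs (chainsBelow xs (j + 0))              ≡⟨ cong (λ k → sumOver xs (chainsBelow xs k)) (ℕ.+-identityʳ j) ⟩
      sumOver xs (chainsBelow xs j)                    ∎
      where open ≡-Reasoning

    -- The recursion visits only entries reached by going down from `x`, so the two lists may differ
    -- elsewhere. `P` singles out the region where they agree, and `to` carries it down.
    chainsBelow-local : ∀ {xs ys : List A} (P : A → Set) → Unique xs → Unique ys →
      (∀ {x y} → P x → R y x → y ∈ˡ xs → y ∈ˡ ys × P y) →
      (∀ {x y} → P x → R y x → y ∈ˡ ys → y ∈ˡ xs) →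
      ∀ j {x} → P x → chainsBelow xs j x ≡ chainsBelow ys j x
    chainsBelow-local P xs! ys! to from zero    px = refl
    chainsBelow-local {xs} {ys} P xs! ys! to from (suc j) {x} px = trans
      (sumOver-cong (filter (λ y → R? y x) xs) λ y∈ →
        let y∈xs , Ryx = ∈-filter⁻ (λ y → R? y x) y∈
        in chainsBelow-local P xs! ys! to from j (proj₂ (to px Ryx y∈xs)))
      (sumOver-↭ (chainsBelow ys j)
        (unique-↭ (Unique.filter⁺ _ xs!) (Unique.filter⁺ _ ys!)
          (λ y∈ → let y∈xs , Ryx = ∈-filter⁻ (λ y → R? y x) y∈ in ∈-filter⁺ (λ y → R? y x) (proj₁ (to px Ryx y∈xs)) Ryx)
          (λ y∈ → let y∈ys , Ryx = ∈-filter⁻ (λ y → R? y x) y∈ in ∈-filter⁺ (λ y → R? y x) (from px Ryx y∈ys) Ryx)))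

  -- Chains of faces of the cube.

  _≟ᴵ_ : DecidableEquality IntervalFace
  lo    ≟ᴵ lo    = yes refl
  lo    ≟ᴵ hi    = no λ ()
  lo    ≟ᴵ whole = no λ ()
  hi    ≟ᴵ lo    = no λ ()
  hi    ≟ᴵ hi    = yes refl
  hi    ≟ᴵ whole = no λ ()
  whole ≟ᴵ lo    = no λ ()
  whole ≟ᴵ hi    = no λ ()
  whole ≟ᴵ whole = yes refl

  wholes : ∀ d → Vec IntervalFace d
  wholes d = replicate d whole

  _≤ⱽ_ : ∀ {d} → Vec IntervalFace d → Vec IntervalFace d → Set
  _≤ⱽ_ = Pointwise _≤ᴵ_

  ≤ⱽ-refl : ∀ {d} {v : Vec IntervalFace d} → v ≤ⱽ v
  ≤ⱽ-refl = PW.refl ≤same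

  ≤ⱽ-wholes : ∀ {d} (v : Vec IntervalFace d) → v ≤ⱽ wholes d
  ≤ⱽ-wholes []      = []
  ≤ⱽ-wholes (a ∷ v) = ≤whole ∷ ≤ⱽ-wholes v

  wholes-max : ∀ {d} {v : Vec IntervalFace d} → wholes d ≤ⱽ v → v ≡ wholes d
  wholes-max {v = []}    []           = refl
  wholes-max {v = _ ∷ v} (≤same ∷ p)  = cong (whole ∷_) (wholes-max p)
  wholes-max {v = _ ∷ v} (≤whole ∷ p) = cong (whole ∷_) (wholes-max p)

  below : ∀ {d} → Vec IntervalFace d → List (Vec IntervalFace d)
  below []          = []
  below (lo ∷ v)    = map (lo ∷_) (below v)
  below (hi ∷ v)    = map (hi ∷_) (below v)
  below (whole ∷ v) = map (whole ∷_) (below v) ++ map (lo ∷_) (v ∷ below v) ++ map (hi ∷_) (v ∷ below v)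

  -- The number of chains of j nonempty cube faces strictly below v.
  cubeChains : ℕ → ∀ {d} → Vec IntervalFace d → ℕ
  cubeChains zero    v = 1
  cubeChains (suc j) v = sumOver (below v) (cubeChains j)

  cubeChains-lo : ∀ j {d} (v : Vec IntervalFace d) → cubeChains j (lo ∷ v) ≡ cubeChains j v
  cubeChains-lo zero    v = refl
  cubeChains-lo (suc j) v = trans (sumOver-map (lo ∷_) (below v) (cubeChains j))
                                  (sumOver-cong (below v) (λ {u} _ → cubeChains-lo j u))

  cubeChains-hi : ∀ j {d} (v : Vec IntervalFace d) → cubeChains j (hi ∷ v) ≡ cubeChains j v
  cubeChains-hi zero    v = refl
  cubeChains-hi (suc j) v = trans (sumOver-map (hi ∷_) (below v) (cubeChains j))
                                  (sumOver-cong (below v) (λ {u} _ → cubeChains-hi j u))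

  -- Along a chain below whole ∷ v the first coordinate leaves lo or hi at most once,
  -- and at that step the remaining coordinates may repeat.
  cubeChains-whole : ∀ j {d} (v : Vec IntervalFace d) →
    cubeChains (suc j) (whole ∷ v)
    ≡ (2 * suc j + 1) * cubeChains (suc j) v + 2 * suc j * cubeChains j v
  cubeChains-whole j v = begin
    cubeChains (suc j) (whole ∷ v)
      ≡⟨ sumOver-++ (map (whole ∷_) (below v)) _ (cubeChains j) ⟩
    sumOver (map (whole ∷_) (below v)) (cubeChains j)
    + sumOver (map (lo ∷_) (v ∷ below v) ++ map (hi ∷_) (v ∷ below v)) (cubeChains j)
      ≡⟨ cong₂ _+_ (whole-part j) (trans (sumOver-++ (map (lo ∷_) (v ∷ below v)) _ (cubeChains j))
           (cong₂ _+_ (lo-part j) (hi-part j))) ⟩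
    ((2 * j + 1) * c (suc j) + 2 * j * c j) + ((c j + c (suc j)) + (c j + c (suc j)))
      ≡⟨ solve 3 (λ j a b → (con 2 :* j :+ con 1) :* a :+ con 2 :* j :* b :+ ((b :+ a) :+ (b :+ a))
                   := (con 2 :* (con 1 :+ j) :+ con 1) :* a :+ con 2 :* (con 1 :+ j) :* b) refl j (c (suc j)) (c j) ⟩
    (2 * suc j + 1) * c (suc j) + 2 * suc j * c j ∎
    where
    open ≡-Reasoning
    open ℕ.+-*-Solver
    c : ℕ → ℕ
    c j = cubeChains j v
    whole-part : ∀ j → sumOver (map (whole ∷_) (below v)) (cubeChains j)
               ≡ (2 * j + 1) * c (suc j) + 2 * j * c j
    whole-part zero = trans (sumOver-map (whole ∷_) (below v) (cubeChains 0))
      (sym (trans (ℕ.+-identityʳ _) (ℕ.*-identityˡ _)))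
    whole-part (suc j) = trans (sumOver-map (whole ∷_) (below v) (cubeChains (suc j)))
      (trans (sumOver-cong (below v) (λ {u} _ → cubeChains-whole j u))
      (trans (sumOver-+ (below v) _ _)
        (cong₂ _+_ (sumOver-* (2 * suc j + 1) (below v) _) (sumOver-* (2 * suc j) (below v) _))))
    lo-part : ∀ j → sumOver (map (lo ∷_) (v ∷ below v)) (cubeChains j) ≡ c j + c (suc j)
    lo-part j = trans (sumOver-map (lo ∷_) (v ∷ below v) (cubeChains j))
      (sumOver-cong (v ∷ below v) (λ {u} _ → cubeChains-lo j u))
    hi-part : ∀ j → sumOver (map (hi ∷_) (v ∷ below v)) (cubeChains j) ≡ c j + c (suc j)
    hi-part j = trans (sumOver-map (hi ∷_) (v ∷ below v) (cubeChains j))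
      (sumOver-cong (v ∷ below v) (λ {u} _ → cubeChains-hi j u))

  ∈-below⁻ : ∀ {d} (v : Vec IntervalFace d) {u} → u ∈ˡ below v → u ≤ⱽ v × u ≢ v
  ∈-below⁻-∷ : ∀ {d} (v : Vec IntervalFace d) {u} → u ∈ˡ v ∷ below v → u ≤ⱽ v

  ∈-below⁻-∷ v (here refl) = ≤ⱽ-refl
  ∈-below⁻-∷ v (there u∈)  = proj₁ (∈-below⁻ v u∈)

  ∈-below⁻ (lo ∷ v) u∈ with ∈-map⁻ (lo ∷_) u∈
  ... | _ , w∈ , refl = let w≤v , w≢v = ∈-below⁻ v w∈ in ≤same ∷ w≤v , w≢v ∘ proj₂ ∘ ∷-injective
  ∈-below⁻ (hi ∷ v) u∈ with ∈-map⁻ (hi ∷_) u∈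
  ... | _ , w∈ , refl = let w≤v , w≢v = ∈-below⁻ v w∈ in ≤same ∷ w≤v , w≢v ∘ proj₂ ∘ ∷-injective
  ∈-below⁻ (whole ∷ v) u∈ with ∈-++⁻ (map (whole ∷_) (below v)) u∈
  ... | inj₁ p with ∈-map⁻ (whole ∷_) p
  ...   | _ , w∈ , refl = let w≤v , w≢v = ∈-below⁻ v w∈ in ≤same ∷ w≤v , w≢v ∘ proj₂ ∘ ∷-injective
  ∈-below⁻ (whole ∷ v) u∈ | inj₂ p with ∈-++⁻ (map (lo ∷_) (v ∷ below v)) p
  ... | inj₁ q with ∈-map⁻ (lo ∷_) q
  ...   | _ , w∈ , refl = ≤whole ∷ ∈-below⁻-∷ v w∈ , λ ()
  ∈-below⁻ (whole ∷ v) u∈ | inj₂ p | inj₂ q with ∈-map⁻ (hi ∷_) q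
  ...   | _ , w∈ , refl = ≤whole ∷ ∈-below⁻-∷ v w∈ , λ ()

  ∈-below⁺ : ∀ {d} {u v : Vec IntervalFace d} → u ≤ⱽ v → u ≢ v → u ∈ˡ below v
  ∈-below⁺-∷ : ∀ {d} {u v : Vec IntervalFace d} → u ≤ⱽ v → u ∈ˡ v ∷ below v

  ∈-below⁺-∷ {u = u} {v} u≤v with ≡-dec _≟ᴵ_ u v
  ... | yes refl = here refl
  ... | no u≢v   = there (∈-below⁺ u≤v u≢v)

  ∈-below⁺ {u = []}    []  u≢v = contradiction refl u≢v
  ∈-below⁺ {u = lo ∷ u}    (≤same ∷ p)  u≢v = ∈-map⁺ (lo ∷_) (∈-below⁺ p (u≢v ∘ cong (lo ∷_)))
  ∈-below⁺ {u = hi ∷ u}    (≤same ∷ p)  u≢v = ∈-map⁺ (hi ∷_) (∈-below⁺ p (u≢v ∘ cong (hi ∷_)))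
  ∈-below⁺ {u = whole ∷ u} (≤same ∷ p)  u≢v = ∈-++⁺ˡ (∈-map⁺ (whole ∷_) (∈-below⁺ p (u≢v ∘ cong (whole ∷_))))
  ∈-below⁺ {u = whole ∷ u} (≤whole ∷ p) u≢v = ∈-++⁺ˡ (∈-map⁺ (whole ∷_) (∈-below⁺ p (u≢v ∘ cong (whole ∷_))))
  ∈-below⁺ {u = lo ∷ u} {_ ∷ v} (≤whole ∷ p) u≢v =
    ∈-++⁺ʳ (map (whole ∷_) (below v)) (∈-++⁺ˡ (∈-map⁺ (lo ∷_) (∈-below⁺-∷ p)))
  ∈-below⁺ {u = hi ∷ u} {_ ∷ v} (≤whole ∷ p) u≢v =
    ∈-++⁺ʳ (map (whole ∷_) (below v)) (∈-++⁺ʳ (map (lo ∷_) (v ∷ below v)) (∈-map⁺ (hi ∷_) (∈-below⁺-∷ p)))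

  below-unique : ∀ {d} (v : Vec IntervalFace d) → Unique (below v)
  below-unique []          = []
  below-unique (lo ∷ v)    = Unique.map⁺ (proj₂ ∘ ∷-injective) (below-unique v)
  below-unique (hi ∷ v)    = Unique.map⁺ (proj₂ ∘ ∷-injective) (below-unique v)
  below-unique {suc d} (whole ∷ v) =
    Unique.++⁺ (Unique.map⁺ (proj₂ ∘ ∷-injective) (below-unique v))
      (Unique.++⁺ (Unique.map⁺ (proj₂ ∘ ∷-injective) v∷below!) (Unique.map⁺ (proj₂ ∘ ∷-injective) v∷below!)
        λ (p , q) → heads {xs = v ∷ below v} {v ∷ below v} (λ ()) p q)
      λ (p , q) → [ heads {ys = v ∷ below v} (λ ()) p , heads {ys = v ∷ below v} (λ ()) p ]′
                    (∈-++⁻ (map (lo ∷_) (v ∷ below v)) q)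
    where
    v∷below! : Unique (v ∷ below v)
    v∷below! = All.tabulate (λ u∈ v≡u → proj₂ (∈-below⁻ v u∈) (sym v≡u)) ∷ below-unique v
    heads : ∀ {a b} {xs ys : List (Vec IntervalFace d)} {u} → a ≢ b → u ∈ˡ map (a ∷_) xs → ¬ u ∈ˡ map (b ∷_) ys
    heads a≢b p q with ∈-map⁻ (_ ∷_) p | ∈-map⁻ (_ ∷_) q
    ... | _ , _ , refl | _ , _ , eq = a≢b (proj₁ (∷-injective eq))

  -- A maximal proper face has exactly one coordinate other than `whole`, and its position does not
  -- affect the count.
  cubeChains-facet : ∀ {d} (v : Vec IntervalFace (suc d)) → v ≢ wholes (suc d) →
    (∀ {u} → u ≢ wholes (suc d) → v ≤ⱽ u → u ≡ v) →
    ∀ j → cubeChains j v ≡ cubeChains j (wholes d)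
  -- Comparison with the proper face `lo ∷ wholes d` forces the remaining coordinates to be `whole`.
  cubeChains-facet {d} (lo ∷ v) v≢ max j
    with refl ← max {lo ∷ wholes d} (λ ()) (≤same ∷ ≤ⱽ-wholes v) = cubeChains-lo j (wholes d)
  cubeChains-facet {d} (hi ∷ v) v≢ max j
    with refl ← max {hi ∷ wholes d} (λ ()) (≤same ∷ ≤ⱽ-wholes v) = cubeChains-hi j (wholes d)
  cubeChains-facet {zero} (whole ∷ []) v≢ max j = contradiction refl v≢
  cubeChains-facet {suc d} (whole ∷ v) v≢ max zero = refl
  -- The exceptional coordinate comes later; the recursion for a leading `whole` expands both counts
  -- in the same way.
  cubeChains-facet {suc d} (whole ∷ v) v≢ max (suc j) = begin
    cubeChains (suc j) (whole ∷ v)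
      ≡⟨ cubeChains-whole j v ⟩
    (2 * suc j + 1) * cubeChains (suc j) v + 2 * suc j * cubeChains j v
      ≡⟨ cong₂ (λ a b → (2 * suc j + 1) * a + 2 * suc j * b) (facet (suc j)) (facet j) ⟩
    (2 * suc j + 1) * cubeChains (suc j) (wholes d) + 2 * suc j * cubeChains j (wholes d)
      ≡⟨ cubeChains-whole j (wholes d) ⟨
    cubeChains (suc j) (wholes (suc d)) ∎
    where
    open ≡-Reasoning
    facet = cubeChains-facet v (v≢ ∘ cong (whole ∷_))
      (λ u≢ v≤u → proj₂ (∷-injective (max (u≢ ∘ proj₂ ∘ ∷-injective) (≤same ∷ v≤u))))

  -- Chains in the boundary complex of a cube.

  ⊆∧≢⇒⊂ : ∀ {n} {p q : Subset n} → p ⊆ q → p ≢ q → p ⊂ q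
  ⊆∧≢⇒⊂ {p = p} {q} p⊆q p≢q with any? (λ x → (x ∈? q) ×-dec ¬? (x ∈? p))
  ... | yes q∖p = p⊆q , q∖p
  ... | no ¬q∖p = ⊥-elim (p≢q (⊆-antisym p⊆q q⊆p))
    where
    q⊆p : q ⊆ p
    q⊆p {x} x∈q with x ∈? p
    ... | yes x∈p = x∈p
    ... | no  x∉p = ⊥-elim (¬q∖p (x , x∈q , x∉p))

  ≢⊥⇒nonempty : ∀ {n} {p : Subset n} → p ≢ ⊥ → Nonempty p
  ≢⊥⇒nonempty {p = p} p≢⊥ with nonempty? p
  ... | yes p≠∅ = p≠∅
  ... | no ¬p≠∅ = ⊥-elim (p≢⊥ (Empty-unique ¬p≠∅))

  cells : ∀ {N} → PolytopalComplex N → List (Subset N)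
  cells 𝒦 = filter nonempty? (faces 𝒦)

  cells-unique : ∀ {N} (𝒦 : PolytopalComplex N) → Unique (cells 𝒦)
  cells-unique 𝒦 = Unique.filter⁺ nonempty? (unique 𝒦)

  cell⇒face : ∀ {N} (𝒦 : PolytopalComplex N) {G} → G ∈ˡ cells 𝒦 → G ∈ᶠ 𝒦
  cell⇒face 𝒦 = proj₁ ∘ ∈-filter⁻ nonempty?

  cell-nonempty : ∀ {N} (𝒦 : PolytopalComplex N) {G} → G ∈ˡ cells 𝒦 → Nonempty G
  cell-nonempty 𝒦 = proj₂ ∘ ∈-filter⁻ nonempty? {xs = faces 𝒦}

  chainsUnder : ∀ {N} → PolytopalComplex N → ℕ → Subset N → ℕ
  chainsUnder 𝒦 = chainsBelow _⊂?_ (cells 𝒦)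

  f-sd : ∀ {N} (𝒦 : PolytopalComplex N) j →
         f-vector (sd 𝒦) (suc j) ≡ sumOver (cells 𝒦) (chainsUnder 𝒦 j)
  f-sd 𝒦 = length-chains _⊂?_ (cells 𝒦)

  unique-map : ∀ {A B : Set} {f : A → B} {xs : List A} →
    (∀ {x y} → x ∈ˡ xs → y ∈ˡ xs → f x ≡ f y → x ≡ y) → Unique xs → Unique (map f xs)
  unique-map inj []          = []
  unique-map inj (x∉ ∷ xs!) =
    All.map⁺ (All.tabulate λ y∈ fx≡fy → All.lookup x∉ y∈ (inj (here refl) (there y∈) fx≡fy))
    ∷ unique-map (λ x∈ y∈ → inj (there x∈) (there y∈)) xs!

  sumOver-split : ∀ {A : Set} {P : A → Set} (P? : U.Decidable P) (xs : List A) (f : A → ℕ) →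
    sumOver xs f ≡ sumOver (filter P? xs) f + sumOver (filter (¬? ∘ P?) xs) f
  sumOver-split P? []       f = refl
  sumOver-split P? (x ∷ xs) f with does (P? x)
  ... | true  = trans (cong (f x +_) (sumOver-split P? xs f)) (sym (ℕ.+-assoc (f x) _ _))
  ... | false = trans (cong (f x +_) (sumOver-split P? xs f))
    (solve 3 (λ a s t → a :+ (s :+ t) := s :+ (a :+ t)) refl
      (f x) (sumOver (filter P? xs) f) (sumOver (filter (¬? ∘ P?) xs) f))
    where open ℕ.+-*-Solver

  module CubeBoundary {N d} (𝒞 : PolytopalComplex N) (isCube : IsCubeBoundary d 𝒞) where

    private
      ϕ = proj₁ isCube
      module Iso = IsOrderIsomorphism (proj₂ isCube)

    prod-proper : ∀ {v : Vec IntervalFace d} → v ≢ wholes d → prod v ≢ prod (wholes d)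
    prod-proper v≢ refl = v≢ refl

    -- Only the order is known to be preserved: the preimage of `⊥` lies above `empty`, so the image
    -- of `empty` lies inside `⊥`.
    ϕ-empty : proj₁ (ϕ (empty , λ ())) ≡ ⊥
    ϕ-empty with Iso.surjective (⊥ , empty-face 𝒞)
    ... | G , ϕG≡⊥ = ⊆-antisym (subst (proj₁ (ϕ (empty , λ ())) ⊆_) (ϕG≡⊥ refl) (Iso.mono {empty , λ ()} {G} empty≤)) ⊥⊆

    -- The value ⊥ at the improper face is never used.
    cubeFace : Vec IntervalFace d → Subset N
    cubeFace v with ≡-dec _≟ᴵ_ v (wholes d)
    ... | yes _  = ⊥
    ... | no v≢ = proj₁ (ϕ (prod v , prod-proper v≢))

    cubeFace-proper : ∀ {v} (v≢ : prod v ≢ prod (wholes d)) → cubeFace v ≡ proj₁ (ϕ (prod v , v≢))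
    cubeFace-proper {v} v≢ with ≡-dec _≟ᴵ_ v (wholes d)
    ... | yes refl = contradiction refl v≢
    ... | no _     = Iso.cong refl

    cubeFace-cell : ∀ {v} → v ≢ wholes d → cubeFace v ∈ˡ cells 𝒞
    cubeFace-cell {v} v≢ rewrite cubeFace-proper (prod-proper v≢) =
      ∈-filter⁺ nonempty? (proj₂ (ϕ _)) (≢⊥⇒nonempty λ ϕv≡⊥ →
        case Iso.injective {prod v , prod-proper v≢} {empty , λ ()} (trans ϕv≡⊥ (sym ϕ-empty)) of λ ())

    cubeFace-mono : ∀ {u v} → u ≢ wholes d → v ≢ wholes d → u ≤ⱽ v → cubeFace u ⊆ cubeFace v
    cubeFace-mono u≢ v≢ u≤v
      rewrite cubeFace-proper (prod-proper u≢) | cubeFace-proper (prod-proper v≢) =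
      Iso.mono (prod≤ u≤v)

    cubeFace-cancel : ∀ {u v} → u ≢ wholes d → v ≢ wholes d → cubeFace u ⊆ cubeFace v → u ≤ⱽ v
    cubeFace-cancel u≢ v≢ u⊆v
      rewrite cubeFace-proper (prod-proper u≢) | cubeFace-proper (prod-proper v≢)
      with prod≤ u≤v ← Iso.cancel {_ , prod-proper u≢} {_ , prod-proper v≢} u⊆v = u≤v

    cubeFace-injective : ∀ {u v} → u ≢ wholes d → v ≢ wholes d → cubeFace u ≡ cubeFace v → u ≡ v
    cubeFace-injective u≢ v≢ eq
      rewrite cubeFace-proper (prod-proper u≢) | cubeFace-proper (prod-proper v≢)
      with refl ← Iso.injective {_ , prod-proper u≢} {_ , prod-proper v≢} eq = refl

    cubeFace-surjective : ∀ {G} → G ∈ˡ cells 𝒞 → ∃ λ v → v ≢ wholes d × G ≡ cubeFace v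
    cubeFace-surjective {G} G∈ with Iso.surjective (G , cell⇒face 𝒞 G∈)
    ... | (empty , p) , ϕ≡G = contradiction
            (subst Nonempty (trans (sym (ϕ≡G refl)) ϕ-empty) (cell-nonempty 𝒞 G∈)) (∉⊥ ∘ proj₂)
    ... | (prod v , p) , ϕ≡G = v , (λ { refl → p refl }) , trans (sym (ϕ≡G refl)) (sym (cubeFace-proper p))

    below-proper : ∀ {u v : Vec IntervalFace d} → u ∈ˡ below v → u ≢ wholes d
    below-proper {v = v} u∈ refl = let w≤v , w≢v = ∈-below⁻ v u∈ in w≢v (sym (wholes-max w≤v))

    -- The list `us` is arbitrary so as to serve twice: for the cells strictly inside a given cell,
    -- and for all of `cells 𝒞`, which is what lies below the improper face `wholes d`.
    below-cells : ∀ v {us} → Unique us →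
      (∀ {u} → u ∈ˡ below v → cubeFace u ∈ˡ us) →
      (∀ {u} → u ≢ wholes d → cubeFace u ∈ˡ us → u ∈ˡ below v) →
      (∀ {G} → G ∈ˡ us → G ∈ˡ cells 𝒞) → us ↭ map cubeFace (below v)
    below-cells v {us} us! to from us⊆ = unique-↭ us!
      (unique-map (λ x∈ y∈ → cubeFace-injective (below-proper {v = v} x∈) (below-proper {v = v} y∈)) (below-unique v))
      forth back
      where
      forth : ∀ {G} → G ∈ˡ us → G ∈ˡ map cubeFace (below v)
      forth G∈ with cubeFace-surjective (us⊆ G∈)
      ... | u , u≢ , refl = ∈-map⁺ cubeFace (from u≢ G∈)
      back : ∀ {G} → G ∈ˡ map cubeFace (below v) → G ∈ˡ us
      back G∈ with ∈-map⁻ cubeFace G∈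
      ... | u , u∈ , refl = to u∈

    chainsUnder-cubeFace : ∀ j {v} → v ≢ wholes d → chainsUnder 𝒞 j (cubeFace v) ≡ cubeChains j v
    chainsUnder-cubeFace zero    v≢ = refl
    chainsUnder-cubeFace (suc j) {v} v≢ = begin
      sumOver (filter (_⊂? cubeFace v) (cells 𝒞)) (chainsUnder 𝒞 j)
        ≡⟨ sumOver-↭ (chainsUnder 𝒞 j) (below-cells v (Unique.filter⁺ (_⊂? cubeFace v) (cells-unique 𝒞)) to from
             (proj₁ ∘ ∈-filter⁻ (_⊂? cubeFace v))) ⟩
      sumOver (map cubeFace (below v)) (chainsUnder 𝒞 j)
        ≡⟨ sumOver-map cubeFace (below v) (chainsUnder 𝒞 j) ⟩
      sumOver (below v) (chainsUnder 𝒞 j ∘ cubeFace)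
        ≡⟨ sumOver-cong (below v) (λ u∈ → chainsUnder-cubeFace j (below-proper {v = v} u∈)) ⟩
      sumOver (below v) (cubeChains j) ∎
      where
      open ≡-Reasoning
      to : ∀ {u} → u ∈ˡ below v → cubeFace u ∈ˡ filter (_⊂? cubeFace v) (cells 𝒞)
      to {u} u∈ = ∈-filter⁺ (_⊂? cubeFace v) (cubeFace-cell u≢)
        (⊆∧≢⇒⊂ (cubeFace-mono u≢ v≢ (proj₁ (∈-below⁻ v u∈)))
                (proj₂ (∈-below⁻ v u∈) ∘ cubeFace-injective u≢ v≢))
        where
        u≢ : u ≢ wholes d
        u≢ = below-proper {v = v} u∈
      from : ∀ {u} → u ≢ wholes d → cubeFace u ∈ˡ filter (_⊂? cubeFace v) (cells 𝒞) → u ∈ˡ below v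
      from u≢ u∈ = let Gu⊂Gv = proj₂ (∈-filter⁻ (_⊂? cubeFace v) {xs = cells 𝒞} u∈) in
        ∈-below⁺ (cubeFace-cancel u≢ v≢ (proj₁ Gu⊂Gv)) (λ { refl → ⊂-irref refl Gu⊂Gv })

    chainsUnder-total : ∀ j → sumOver (cells 𝒞) (chainsUnder 𝒞 j) ≡ cubeChains (suc j) (wholes d)
    chainsUnder-total j = trans
      (sumOver-↭ (chainsUnder 𝒞 j) (below-cells (wholes d) (cells-unique 𝒞)
        (λ u∈ → cubeFace-cell (below-proper {v = wholes d} u∈))
        (λ u≢ _ → ∈-below⁺ (≤ⱽ-wholes _) u≢) (λ G∈ → G∈)))
      (trans (sumOver-map cubeFace (below (wholes d)) (chainsUnder 𝒞 j))
        (sumOver-cong (below (wholes d)) (λ u∈ → chainsUnder-cubeFace j (below-proper {v = wholes d} u∈))))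

    f-sd-cube : ∀ j → f-vector (sd 𝒞) j ≡ cubeChains j (wholes d)
    f-sd-cube zero    = refl
    f-sd-cube (suc j) = trans (f-sd 𝒞 j) (chainsUnder-total j)

  chainsUnder-facet : ∀ {N d} (𝒞 : PolytopalComplex N) → IsCubeBoundary d 𝒞 →
    ∀ {F} → F ≢ ⊥ → IsFacet 𝒞 F →
    ∃ λ d′ → d ≡ suc d′ × (∀ j → chainsUnder 𝒞 j F ≡ cubeChains j (wholes d′))
  chainsUnder-facet {d = d} 𝒞 isCube {F} F≢⊥ (F∈ , F-max)
    with CubeBoundary.cubeFace-surjective 𝒞 isCube {F} (∈-filter⁺ nonempty? F∈ (≢⊥⇒nonempty F≢⊥))
  -- The boundary of the 0-cube has no nonempty face, so the dimension is positive.
  chainsUnder-facet {d = zero}  𝒞 isCube F≢⊥ (F∈ , F-max) | [] , v≢ , refl = ⊥-elim (v≢ refl)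
  chainsUnder-facet {d = suc d} 𝒞 isCube F≢⊥ (F∈ , F-max) | v , v≢ , refl =
    d , refl , λ j → trans (chainsUnder-cubeFace j v≢)
      (cubeChains-facet v v≢
        (λ u≢ v≤u → cubeFace-injective u≢ v≢
          (F-max (cell⇒face 𝒞 (cubeFace-cell u≢)) (cubeFace-mono v≢ u≢ v≤u))) j)
    where open CubeBoundary 𝒞 isCube

  -- The effect of a capping on the chain counts.

  module Capping {N d} {𝒬 𝒫 : PolytopalComplex N} (isCapping : IsCapping d 𝒬 𝒫) where

    open IsCapping isCapping

    -- `𝒫` contains the empty face, whereas `union` removes `F` from `𝒫`.
    F≢⊥ : F ≢ ⊥
    F≢⊥ F≡⊥ = proj₂ (Equivalence.to (union ⊥) (empty-face 𝒫)) (sym F≡⊥)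

    F∈𝒬 : F ∈ᶠ 𝒬
    F∈𝒬 = proj₁ facet-𝒬

    F∈𝒞 : F ∈ᶠ 𝒞
    F∈𝒞 = proj₁ facet-𝒞

    F-nonempty : Nonempty F
    F-nonempty = ≢⊥⇒nonempty F≢⊥

    𝒬∩𝒞⇒⊆F : ∀ {G} → G ∈ᶠ 𝒬 → G ∈ᶠ 𝒞 → G ⊆ F
    𝒬∩𝒞⇒⊆F {G} G∈𝒬 G∈𝒞 = proj₂ (Equivalence.to (meet-𝒬 G) (G∈𝒬 , G∈𝒞))

    𝒬-⊆F : ∀ {G} → G ∈ᶠ 𝒬 → G ⊆ F → G ∈ᶠ 𝒞
    𝒬-⊆F {G} G∈𝒬 G⊆F = proj₂ (Equivalence.from (meet-𝒬 G) (G∈𝒬 , G⊆F))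

    𝒞-⊆F : ∀ {G} → G ∈ᶠ 𝒞 → G ⊆ F → G ∈ᶠ 𝒬
    𝒞-⊆F {G} G∈𝒞 G⊆F = proj₁ (Equivalence.from (meet-𝒞 G) (G∈𝒞 , G⊆F))

    -- A face of one complex inside a face of the other has all its vertices in F.
    𝒬-down : ∀ {G H} → G ∈ᶠ 𝒞 → G ⊆ H → H ∈ᶠ 𝒬 → G ∈ᶠ 𝒬
    𝒬-down G∈𝒞 G⊆H H∈𝒬 = 𝒞-⊆F G∈𝒞 λ {v} v∈G →
      𝒬∩𝒞⇒⊆F (vertex-face 𝒬 (G⊆H v∈G) H∈𝒬) (vertex-face 𝒞 v∈G G∈𝒞) (x∈⁅x⁆ v)

    𝒞-down : ∀ {G H} → G ∈ᶠ 𝒬 → G ⊆ H → H ∈ᶠ 𝒞 → G ∈ᶠ 𝒞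
    𝒞-down G∈𝒬 G⊆H H∈𝒞 = 𝒬-⊆F G∈𝒬 λ {v} v∈G →
      𝒬∩𝒞⇒⊆F (vertex-face 𝒬 v∈G G∈𝒬) (vertex-face 𝒞 (G⊆H v∈G) H∈𝒞) (x∈⁅x⁆ v)

    𝒬⇒𝒫 : ∀ {G} → G ∈ˡ cells 𝒬 → G ≢ F → G ∈ˡ cells 𝒫
    𝒬⇒𝒫 {G} G∈ G≢F =
      ∈-filter⁺ nonempty? (Equivalence.from (union G) (inj₁ (cell⇒face 𝒬 G∈) , G≢F)) (cell-nonempty 𝒬 G∈)

    𝒞⇒𝒫 : ∀ {G} → G ∈ˡ cells 𝒞 → G ≢ F → G ∈ˡ cells 𝒫
    𝒞⇒𝒫 {G} G∈ G≢F =
      ∈-filter⁺ nonempty? (Equivalence.from (union G) (inj₂ (cell⇒face 𝒞 G∈) , G≢F)) (cell-nonempty 𝒞 G∈)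

    𝒫⇒𝒬⊎𝒞 : ∀ {G} → G ∈ˡ cells 𝒫 → (G ∈ˡ cells 𝒬 ⊎ G ∈ˡ cells 𝒞) × G ≢ F
    𝒫⇒𝒬⊎𝒞 {G} G∈ with Equivalence.to (union G) (cell⇒face 𝒫 G∈)
    ... | inj₁ G∈𝒬 , G≢F = inj₁ (∈-filter⁺ nonempty? G∈𝒬 (cell-nonempty 𝒫 G∈)) , G≢F
    ... | inj₂ G∈𝒞 , G≢F = inj₂ (∈-filter⁺ nonempty? G∈𝒞 (cell-nonempty 𝒫 G∈)) , G≢F

    -- The capping removes `F` and adds faces of the cube, and neither happens below `G`: `F` is a
    -- facet different from `G`, and a face of the cube inside `G` is already in `𝒬` by `𝒬-down`.
    chainsUnder-𝒬 : ∀ j {G} → G ∈ᶠ 𝒬 → G ≢ F → chainsUnder 𝒫 j G ≡ chainsUnder 𝒬 j G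
    chainsUnder-𝒬 j G∈𝒬 G≢F = chainsBelow-local _⊂?_ (λ G → G ∈ᶠ 𝒬 × G ≢ F)
      (cells-unique 𝒫) (cells-unique 𝒬)
      (λ (G∈𝒬 , _) H⊂G H∈𝒫 →
        let H∈ , H≢F = 𝒫⇒𝒬⊎𝒞 H∈𝒫
            H∈𝒬 = [ cell⇒face 𝒬 , (λ H∈𝒞 → 𝒬-down (cell⇒face 𝒞 H∈𝒞) (proj₁ H⊂G) G∈𝒬) ]′ H∈
        in ∈-filter⁺ nonempty? H∈𝒬 (cell-nonempty 𝒫 H∈𝒫) , H∈𝒬 , H≢F)
      (λ { (G∈𝒬 , G≢F) H⊂G H∈𝒬 → 𝒬⇒𝒫 H∈𝒬 λ { refl → G≢F (proj₂ facet-𝒬 G∈𝒬 (proj₁ H⊂G)) } })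
      j (G∈𝒬 , G≢F)

    chainsUnder-𝒞 : ∀ j {G} → G ∈ᶠ 𝒞 → G ≢ F → chainsUnder 𝒫 j G ≡ chainsUnder 𝒞 j G
    chainsUnder-𝒞 j G∈𝒞 G≢F = chainsBelow-local _⊂?_ (λ G → G ∈ᶠ 𝒞 × G ≢ F)
      (cells-unique 𝒫) (cells-unique 𝒞)
      (λ (G∈𝒞 , _) H⊂G H∈𝒫 →
        let H∈ , H≢F = 𝒫⇒𝒬⊎𝒞 H∈𝒫
            H∈𝒞 = [ (λ H∈𝒬 → 𝒞-down (cell⇒face 𝒬 H∈𝒬) (proj₁ H⊂G) G∈𝒞) , cell⇒face 𝒞 ]′ H∈
        in ∈-filter⁺ nonempty? H∈𝒞 (cell-nonempty 𝒫 H∈𝒫) , H∈𝒞 , H≢F)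
      (λ { (G∈𝒞 , G≢F) H⊂G H∈𝒞 → 𝒞⇒𝒫 H∈𝒞 λ { refl → G≢F (proj₂ facet-𝒞 G∈𝒞 (proj₁ H⊂G)) } })
      j (G∈𝒞 , G≢F)

    chainsUnder-F : ∀ j → chainsUnder 𝒬 j F ≡ chainsUnder 𝒞 j F
    chainsUnder-F j = chainsBelow-local _⊂?_ (_⊆ F) (cells-unique 𝒬) (cells-unique 𝒞)
      (λ G⊆F H⊂G H∈𝒬 →
        ∈-filter⁺ nonempty? (𝒬-⊆F (cell⇒face 𝒬 H∈𝒬) (λ v∈H → G⊆F (proj₁ H⊂G v∈H))) (cell-nonempty 𝒬 H∈𝒬)
        , λ v∈H → G⊆F (proj₁ H⊂G v∈H))
      (λ G⊆F H⊂G H∈𝒞 →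
        ∈-filter⁺ nonempty? (𝒞-⊆F (cell⇒face 𝒞 H∈𝒞) (λ v∈H → G⊆F (proj₁ H⊂G v∈H))) (cell-nonempty 𝒞 H∈𝒞))
      j ⊆-refl

    private
      open DecMembership (≡-dec {n = N} Bool._≟_) using () renaming (_∈?_ to _∈ˡ?_)

      in𝒬? : U.Decidable (_∈ˡ cells 𝒬)
      in𝒬? G = G ∈ˡ? cells 𝒬

      -- The first two lists partition the cells of `𝒫`. Thus `𝒞∖F` has only the cells of the cube
      -- not contained in `F`; the proper faces of `F`, listed in `𝒞⊂F`, belong to `𝒬∖F`.
      𝒬∖F 𝒞∖F 𝒞⊂F : List (Subset N)
      𝒬∖F = filter in𝒬? (cells 𝒫)
      𝒞∖F = filter (¬? ∘ in𝒬?) (cells 𝒫)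
      𝒞⊂F = filter (_⊂? F) (cells 𝒞)

      𝒬∖F⁻ : ∀ {G} → G ∈ˡ 𝒬∖F → G ∈ˡ cells 𝒬 × G ≢ F
      𝒬∖F⁻ G∈ = let G∈𝒫 , G∈𝒬 = ∈-filter⁻ in𝒬? G∈ in G∈𝒬 , proj₂ (𝒫⇒𝒬⊎𝒞 G∈𝒫)

      𝒞∖F⁻ : ∀ {G} → G ∈ˡ 𝒞∖F → G ∈ˡ cells 𝒞 × (¬ G ∈ˡ cells 𝒬) × G ≢ F
      𝒞∖F⁻ G∈ with ∈-filter⁻ (¬? ∘ in𝒬?) G∈
      ... | G∈𝒫 , G∉𝒬 with 𝒫⇒𝒬⊎𝒞 G∈𝒫
      ...   | inj₁ G∈𝒬 , G≢F = contradiction G∈𝒬 G∉𝒬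
      ...   | inj₂ G∈𝒞 , G≢F = G∈𝒞 , G∉𝒬 , G≢F

      F∈cells𝒬 : F ∈ˡ cells 𝒬
      F∈cells𝒬 = ∈-filter⁺ nonempty? F∈𝒬 F-nonempty

      F∈cells𝒞 : F ∈ˡ cells 𝒞
      F∈cells𝒞 = ∈-filter⁺ nonempty? F∈𝒞 F-nonempty

      cells-𝒬 : cells 𝒬 ↭ F ∷ 𝒬∖F
      cells-𝒬 = unique-↭ (cells-unique 𝒬)
        (All.tabulate (λ G∈ F≡G → proj₂ (𝒬∖F⁻ G∈) (sym F≡G)) ∷ Unique.filter⁺ in𝒬? (cells-unique 𝒫))
        to λ { (here refl) → F∈cells𝒬 ; (there G∈) → proj₁ (𝒬∖F⁻ G∈) }
        where
        to : ∀ {G} → G ∈ˡ cells 𝒬 → G ∈ˡ F ∷ 𝒬∖F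
        to {G} G∈ with ≡-dec Bool._≟_ G F
        ... | yes refl = here refl
        ... | no G≢F   = there (∈-filter⁺ in𝒬? (𝒬⇒𝒫 G∈ G≢F) G∈)

      cells-𝒞 : cells 𝒞 ↭ F ∷ 𝒞⊂F ++ 𝒞∖F
      cells-𝒞 = unique-↭ (cells-unique 𝒞)
        (All.tabulate F∉ ∷ Unique.++⁺ (Unique.filter⁺ (_⊂? F) (cells-unique 𝒞))
                                      (Unique.filter⁺ (¬? ∘ in𝒬?) (cells-unique 𝒫)) disjoint)
        to from
        where
        ⊂F⇒∈𝒬 : ∀ {G} → G ∈ˡ 𝒞⊂F → G ∈ˡ cells 𝒬
        ⊂F⇒∈𝒬 G∈ = let G∈𝒞 , G⊂F = ∈-filter⁻ (_⊂? F) G∈ in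
          ∈-filter⁺ nonempty? (𝒞-⊆F (cell⇒face 𝒞 G∈𝒞) (proj₁ G⊂F)) (cell-nonempty 𝒞 G∈𝒞)
        disjoint : ∀ {G} → ¬ (G ∈ˡ 𝒞⊂F × G ∈ˡ 𝒞∖F)
        disjoint (p , q) = proj₁ (proj₂ (𝒞∖F⁻ q)) (⊂F⇒∈𝒬 p)
        F∉ : ∀ {G} → G ∈ˡ 𝒞⊂F ++ 𝒞∖F → F ≢ G
        F∉ G∈ refl with ∈-++⁻ 𝒞⊂F G∈
        ... | inj₁ p = ⊂-irref refl (proj₂ (∈-filter⁻ (_⊂? F) {xs = cells 𝒞} p))
        ... | inj₂ q = proj₂ (proj₂ (𝒞∖F⁻ q)) refl
        to : ∀ {G} → G ∈ˡ cells 𝒞 → G ∈ˡ F ∷ 𝒞⊂F ++ 𝒞∖F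
        to {G} G∈ with ≡-dec Bool._≟_ G F
        ... | yes refl = here refl
        ... | no G≢F with in𝒬? G
        ...   | yes G∈𝒬 = there (∈-++⁺ˡ (∈-filter⁺ (_⊂? F) G∈
                  (⊆∧≢⇒⊂ (𝒬∩𝒞⇒⊆F (cell⇒face 𝒬 G∈𝒬) (cell⇒face 𝒞 G∈)) G≢F)))
        ...   | no G∉𝒬  = there (∈-++⁺ʳ 𝒞⊂F (∈-filter⁺ (¬? ∘ in𝒬?) (𝒞⇒𝒫 G∈ G≢F) G∉𝒬))
        from : ∀ {G} → G ∈ˡ F ∷ 𝒞⊂F ++ 𝒞∖F → G ∈ˡ cells 𝒞
        from (here refl) = F∈cells𝒞
        from (there G∈) with ∈-++⁻ 𝒞⊂F G∈
        ... | inj₁ p = proj₁ (∈-filter⁻ (_⊂? F) p)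
        ... | inj₂ q = proj₁ (𝒞∖F⁻ q)

    -- Sorted by greatest element, the chains of `𝒬` and `𝒞` together contain those ending in `F`
    -- twice although `𝒫` has none of them, and those made of `j + 1` proper faces of `F` twice
    -- although `𝒫` has them once.
    f-sd-union : ∀ j →
      f-vector (sd 𝒫) (suc j) + (2 * chainsUnder 𝒞 j F + chainsUnder 𝒞 (suc j) F)
      ≡ f-vector (sd 𝒬) (suc j) + f-vector (sd 𝒞) (suc j)
    f-sd-union j = begin
      f-vector (sd 𝒫) (suc j) + (2 * chainsUnder 𝒞 j F + sC)
        ≡⟨ cong (_+ (2 * chainsUnder 𝒞 j F + sC)) (trans (f-sd 𝒫 j) (trans (sumOver-split in𝒬? (cells 𝒫) (chainsUnder 𝒫 j))
           (cong₂ _+_ (sumOver-cong 𝒬∖F (λ G∈ → let G∈𝒬 , G≢F = 𝒬∖F⁻ G∈ in chainsUnder-𝒬 j (cell⇒face 𝒬 G∈𝒬) G≢F))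
                      (sumOver-cong 𝒞∖F (λ G∈ → let G∈𝒞 , _ , G≢F = 𝒞∖F⁻ G∈ in chainsUnder-𝒞 j (cell⇒face 𝒞 G∈𝒞) G≢F))))) ⟩
      (sumOver 𝒬∖F (chainsUnder 𝒬 j) + sumOver 𝒞∖F (chainsUnder 𝒞 j)) + (2 * chainsUnder 𝒞 j F + sC)
        ≡⟨ solve 4 (λ a b f s → (a :+ b) :+ (con 2 :* f :+ s) := (f :+ a) :+ (f :+ (s :+ b))) refl
             (sumOver 𝒬∖F (chainsUnder 𝒬 j)) (sumOver 𝒞∖F (chainsUnder 𝒞 j)) (chainsUnder 𝒞 j F) sC ⟩
      (chainsUnder 𝒞 j F + sumOver 𝒬∖F (chainsUnder 𝒬 j)) + (chainsUnder 𝒞 j F + (sC + sumOver 𝒞∖F (chainsUnder 𝒞 j)))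
        ≡⟨ cong₂ _+_ (cong (_+ sumOver 𝒬∖F (chainsUnder 𝒬 j)) (chainsUnder-F j))
                     (cong (chainsUnder 𝒞 j F +_) (sumOver-++ 𝒞⊂F 𝒞∖F (chainsUnder 𝒞 j))) ⟨
      sumOver (F ∷ 𝒬∖F) (chainsUnder 𝒬 j) + sumOver (F ∷ 𝒞⊂F ++ 𝒞∖F) (chainsUnder 𝒞 j)
        ≡⟨ cong₂ _+_ (sumOver-↭ (chainsUnder 𝒬 j) cells-𝒬) (sumOver-↭ (chainsUnder 𝒞 j) cells-𝒞) ⟨
      sumOver (cells 𝒬) (chainsUnder 𝒬 j) + sumOver (cells 𝒞) (chainsUnder 𝒞 j)
        ≡⟨ cong₂ _+_ (f-sd 𝒬 j) (f-sd 𝒞 j) ⟨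
      f-vector (sd 𝒬) (suc j) + f-vector (sd 𝒞) (suc j) ∎
      where
      open ≡-Reasoning
      open ℕ.+-*-Solver
      sC : ℕ
      sC = chainsUnder 𝒞 (suc j) F

  f-sd-capping : ∀ {N d} {𝒬 𝒫 : PolytopalComplex N} → IsCapping d 𝒬 𝒫 →
    ∃ λ d′ → d ≡ suc d′ × (∀ j →
      f-vector (sd 𝒫) (suc j) + (2 * cubeChains j (wholes d′) + cubeChains (suc j) (wholes d′))
      ≡ f-vector (sd 𝒬) (suc j) + cubeChains (suc j) (wholes d))
  f-sd-capping {d = d} {𝒬} {𝒫} isCapping
    with chainsUnder-facet 𝒞 (IsCapping.cube isCapping) (Capping.F≢⊥ isCapping) facet-𝒞
    where open IsCapping isCapping hiding (cube)
  ... | d′ , d≡1+d′ , under-F = d′ , d≡1+d′ , λ j → trans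
      (cong (f-vector (sd 𝒫) (suc j) +_) (sym (cong₂ (λ a b → 2 * a + b) (under-F j) (under-F (suc j)))))
      (trans (Capping.f-sd-union isCapping j)
             (cong (f-vector (sd 𝒬) (suc j) +_) (CubeBoundary.f-sd-cube (IsCapping.𝒞 isCapping) (IsCapping.cube isCapping) (suc j))))

-- Chain counts as coefficients in the basis `C(m, j)`.

open ChainCounts

-- A sequence φ stands for the polynomial Σ_j φ j · C(m, j) in m, and the operators
-- multiply it by 2m, 2m + 1 and 2m + 2 and substitute m + 1 for m.

2m· 2m+1· 2m+2· shift : (ℕ → ℕ) → ℕ → ℕ
2m·   φ zero    = 0
2m·   φ (suc j) = 2 ℕ.* suc j ℕ.* (φ (suc j) ℕ.+ φ j)
2m+1· φ j       = 2m· φ j ℕ.+ φ j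
2m+2· φ j       = 2m+1· φ j ℕ.+ φ j
shift φ j       = φ j ℕ.+ φ (suc j)

one : ℕ → ℕ
one zero    = 1
one (suc _) = 0

-- (2m)^p (2m + 1)^q and (2m + 1)^q (2m + 2)^r
lowPower highPower : ℕ → ℕ → ℕ → ℕ
lowPower zero    zero    = one
lowPower zero    (suc q) = 2m+1· (lowPower zero q)
lowPower (suc p) q       = 2m· (lowPower p q)
highPower zero    zero    = one
highPower zero    (suc r) = 2m+2· (highPower zero r)
highPower (suc q) r       = 2m+1· (highPower q r)

2m·-cong : ∀ {φ χ} → φ ≗ χ → 2m· φ ≗ 2m· χ
2m·-cong φ≗χ zero    = refl
2m·-cong φ≗χ (suc j) = cong (2 ℕ.* suc j ℕ.*_) (cong₂ ℕ._+_ (φ≗χ (suc j)) (φ≗χ j))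

2m+1·-cong : ∀ {φ χ} → φ ≗ χ → 2m+1· φ ≗ 2m+1· χ
2m+1·-cong φ≗χ j = cong₂ ℕ._+_ (2m·-cong φ≗χ j) (φ≗χ j)

2m+2·-cong : ∀ {φ χ} → φ ≗ χ → 2m+2· φ ≗ 2m+2· χ
2m+2·-cong φ≗χ j = cong₂ ℕ._+_ (2m+1·-cong φ≗χ j) (φ≗χ j)

2m·-2m+1· : ∀ φ → 2m· (2m+1· φ) ≗ 2m+1· (2m· φ)
2m·-2m+1· φ zero    = refl
2m·-2m+1· φ (suc j) = solve 5
  (λ k a b c d → k :* ((a :+ c) :+ (b :+ d)) := k :* (a :+ b) :+ k :* (c :+ d)) refl
  (2 ℕ.* suc j) (2m· φ (suc j)) (2m· φ j) (φ (suc j)) (φ j)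
  where open ℕ.+-*-Solver

2m+1·-2m+2· : ∀ φ → 2m+1· (2m+2· φ) ≗ 2m+2· (2m+1· φ)
2m+1·-2m+2· φ zero    = refl
2m+1·-2m+2· φ (suc j) = solve 4
  (λ k b c d → k :* ((k :* (c :+ d) :+ c :+ c) :+ (b :+ d :+ d)) :+ (k :* (c :+ d) :+ c :+ c)
            := k :* ((k :* (c :+ d) :+ c) :+ (b :+ d)) :+ (k :* (c :+ d) :+ c) :+ (k :* (c :+ d) :+ c)) refl
  (2 ℕ.* suc j) (2m· φ j) (φ (suc j)) (φ j)
  where open ℕ.+-*-Solver

shift-2m· : ∀ φ → shift (2m· φ) ≗ 2m+2· (shift φ)
shift-2m· φ zero    = solve 2 (λ a b → con 2 :* (b :+ a) := (a :+ b) :+ (a :+ b)) refl (φ 0) (φ 1)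
  where open ℕ.+-*-Solver
shift-2m· φ (suc j) = solve 4 (λ j a b c →
    con 2 :* (con 1 :+ j) :* (b :+ a) :+ con 2 :* (con 2 :+ j) :* (c :+ b)
    := con 2 :* (con 1 :+ j) :* ((b :+ c) :+ (a :+ b)) :+ (b :+ c) :+ (b :+ c)) refl
  j (φ j) (φ (suc j)) (φ (suc (suc j)))
  where open ℕ.+-*-Solver

-- In `lowPower` the factors `2m` are applied last, so a new factor `2m + 1` has to commute past
-- them.
lowPower-suc : ∀ p q → 2m+1· (lowPower p q) ≗ lowPower p (suc q)
lowPower-suc zero    q j = refl
lowPower-suc (suc p) q j =
  trans (sym (2m·-2m+1· (lowPower p q) j)) (2m·-cong (lowPower-suc p q) j)

highPower-suc : ∀ q r → 2m+2· (highPower q r) ≗ highPower q (suc r)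
highPower-suc zero    r j = refl
highPower-suc (suc q) r j =
  trans (sym (2m+1·-2m+2· (highPower q r) j)) (2m+1·-cong (highPower-suc q r) j)

lowPower≗highPower : ∀ q → lowPower 0 q ≗ highPower q 0
lowPower≗highPower zero    j = refl
lowPower≗highPower (suc q) j = 2m+1·-cong (lowPower≗highPower q) j

shift-lowPower : ∀ p → shift (lowPower p 0) ≗ highPower 0 p
shift-lowPower zero    zero    = refl
shift-lowPower zero    (suc j) = refl
shift-lowPower (suc p) j = trans (shift-2m· (lowPower p 0) j) (2m+2·-cong (shift-lowPower p) j)

-- By `m C(m, j) = j C(m, j) + (j + 1) C(m, j +
-- 1)`, the recursion `cubeChains-whole` is multiplication by `2m + 1` in the basis `C(m, j)`.
cubeChains≗lowPower : ∀ d → (λ j → cubeChains j (wholes d)) ≗ lowPower 0 d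
cubeChains≗lowPower zero    zero    = refl
cubeChains≗lowPower zero    (suc j) = refl
cubeChains≗lowPower (suc d) zero    = cubeChains≗lowPower d 0
cubeChains≗lowPower (suc d) (suc j) = trans (cubeChains-whole j (wholes d))
  (trans (solve 3 (λ k a b → (k :+ con 1) :* a :+ k :* b := k :* (a :+ b) :+ a) refl
           (2 ℕ.* suc j) (cubeChains (suc j) (wholes d)) (cubeChains j (wholes d)))
         (2m+1·-cong (cubeChains≗lowPower d) (suc j)))
  where open ℕ.+-*-Solver

-- The excess of the f-vectors of the two pieces over that of their union along a facet.
overcount : ℕ → ℕ → ℕ
overcount d zero    = 1
overcount d (suc j) = 2 ℕ.* cubeChains j (wholes d) ℕ.+ cubeChains (suc j) (wholes d)

double-+ : ∀ a b → 2 ℕ.* a ℕ.+ b ≡ a ℕ.+ (a ℕ.+ b)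
double-+ = solve 2 (λ a b → con 2 :* a :+ b := a :+ (a :+ b)) refl
  where open ℕ.+-*-Solver

-- A bound on the degree in `m`, which decides how far a numerator has to be summed.
VanishesAbove : ℕ → (ℕ → ℕ) → Set
VanishesAbove d φ = ∀ {j} → d < j → φ j ≡ 0

vanishes-2m· : ∀ {d φ} → VanishesAbove d φ → VanishesAbove (suc d) (2m· φ)
vanishes-2m· {d} {φ} van {suc j} (s≤s d<j) =
  trans (cong (2 ℕ.* suc j ℕ.*_) (cong₂ ℕ._+_ (van (ℕ.m≤n⇒m≤1+n d<j)) (van d<j)))
        (ℕ.*-zeroʳ (2 ℕ.* suc j))

vanishes-2m+1· : ∀ {d φ} → VanishesAbove d φ → VanishesAbove (suc d) (2m+1· φ)
vanishes-2m+1· van d<j = cong₂ ℕ._+_ (vanishes-2m· van d<j) (van (ℕ.<⇒≤ d<j))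

vanishes-2m+2· : ∀ {d φ} → VanishesAbove d φ → VanishesAbove (suc d) (2m+2· φ)
vanishes-2m+2· van d<j = cong₂ ℕ._+_ (vanishes-2m+1· van d<j) (van (ℕ.<⇒≤ d<j))

vanishes-lowPower : ∀ p q → VanishesAbove (p ℕ.+ q) (lowPower p q)
vanishes-lowPower zero    zero    (s≤s _) = refl
vanishes-lowPower zero    (suc q) = vanishes-2m+1· (vanishes-lowPower zero q)
vanishes-lowPower (suc p) q       = vanishes-2m· (vanishes-lowPower p q)

vanishes-highPower : ∀ q r → VanishesAbove (q ℕ.+ r) (highPower q r)
vanishes-highPower zero    zero    (s≤s _) = refl
vanishes-highPower zero    (suc r) = vanishes-2m+2· (vanishes-highPower zero r)
vanishes-highPower (suc q) r       = vanishes-2m+1· (vanishes-highPower q r)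

-- Identifies the indices `n` and `n + 1`. In the family of level `n` these are the two copies of
-- `(2m+1)^n`, at the end of the first half and the start of the second.
skip : ℕ → ℕ → ℕ
skip zero    zero    = zero
skip zero    (suc i) = i
skip (suc n) zero    = zero
skip (suc n) (suc i) = suc (skip n i)

skip-≤ : ∀ {n i} → i ≤ n → skip n i ≡ i
skip-≤ {zero}  z≤n       = refl
skip-≤ {suc n} z≤n       = refl
skip-≤ {suc n} (s≤s i≤n) = cong suc (skip-≤ i≤n)

skip-> : ∀ n i → skip n (i ℕ.+ suc n) ≡ i ℕ.+ n
skip-> zero    i = trans (cong (skip 0) (ℕ.+-suc i 0)) refl
skip-> (suc n) i = trans (cong (skip (suc n)) (ℕ.+-suc i (suc n)))
  (trans (cong suc (skip-> n i)) (sym (ℕ.+-suc i n)))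

skip-mono : ∀ n {i j} → i ≤ j → skip n i ≤ skip n j
skip-mono zero    {zero}          _         = z≤n
skip-mono zero    {suc i} {suc j} (s≤s i≤j) = i≤j
skip-mono (suc n) {zero}          _         = z≤n
skip-mono (suc n) {suc i} {suc j} (s≤s i≤j) = s≤s (skip-mono n i≤j)

-- Numerators of power series and their recursion, with `w` in the role of `1 - z`.

module Interlacing {A : Set} {add mul : A → A → A} {zer unit : A}
  (isCommutativeSemiring : IsCommutativeSemiring _≡_ add mul zer unit)
  (z w : A) (z+w≡1 : add z w ≡ unit) where

  private
    R : CommutativeSemiring _ _
    R = record { isCommutativeSemiring = isCommutativeSemiring }

  open CommutativeSemiring R
    using (_+_; _*_; 0#; 1#; +-assoc; +-comm; +-identityˡ; +-identityʳ; *-identityˡ; zeroˡ; zeroʳ; distribˡ; distribʳ)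
  open NaturalCoefficients R
  open RawSemiringOps (CommutativeSemiring.rawSemiring R) using (_^_) renaming (_×_ to _·_)
  open Mult (CommutativeSemiring.+-monoid R) using (×-homo-+)

  split : ∀ a → a ≡ z * a + w * a
  split a = trans (sym (*-identityˡ a)) (trans (cong (_* a) (sym z+w≡1)) (distribʳ a z w))

  ι : ℕ → A
  ι n = n · 1#

  ι-+ : ∀ m n → ι (m ℕ.+ n) ≡ ι m + ι n
  ι-+ m n = ×-homo-+ 1# m n

  -- Σ_{j ≤ d} φ j z^j w^(d - j)
  hsum : ℕ → (ℕ → ℕ) → A
  hsum zero    φ = ι (φ 0)
  hsum (suc d) φ = w ^ suc d * ι (φ 0) + z * hsum d (φ ∘ suc)

  hsum-cong : ∀ d {φ χ} → φ ≗ χ → hsum d φ ≡ hsum d χ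
  hsum-cong zero    φ≗χ = cong ι (φ≗χ 0)
  hsum-cong (suc d) φ≗χ = cong₂ (λ a b → w ^ suc d * a + z * b)
    (cong ι (φ≗χ 0)) (hsum-cong d (φ≗χ ∘ suc))

  hsum-+ : ∀ d φ χ → hsum d (λ j → φ j ℕ.+ χ j) ≡ hsum d φ + hsum d χ
  hsum-+ zero    φ χ = ι-+ (φ 0) (χ 0)
  hsum-+ (suc d) φ χ = trans
    (cong₂ (λ a b → w ^ suc d * a + z * b) (ι-+ (φ 0) (χ 0)) (hsum-+ d (φ ∘ suc) (χ ∘ suc)))
    (solve 6 (λ p a b z c d → p :* (a :+ b) :+ z :* (c :+ d) := (p :* a :+ z :* c) :+ (p :* b :+ z :* d)) refl
      (w ^ suc d) (ι (φ 0)) (ι (χ 0)) z (hsum d (φ ∘ suc)) (hsum d (χ ∘ suc)))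

  -- The series is unchanged while its denominator gains a factor `w`, and so must the numerator.
  hsum-suc : ∀ d {φ} → φ (suc d) ≡ 0 → hsum (suc d) φ ≡ w * hsum d φ
  hsum-suc zero    {φ} φ≡0 = trans
    (cong (λ k → w * 1# * ι (φ 0) + z * ι k) φ≡0)
    (solve 3 (λ w a z → w :* con 1 :* a :+ z :* con 0 := w :* a) refl w (ι (φ 0)) z)
  hsum-suc (suc d) {φ} φ≡0 = trans
    (cong (λ b → w * w ^ suc d * ι (φ 0) + z * b) (hsum-suc d {φ ∘ suc} φ≡0))
    (solve 5 (λ w p a z b → w :* p :* a :+ z :* (w :* b) := w :* (p :* a :+ z :* b)) refl
      w (w ^ suc d) (ι (φ 0)) z (hsum d (φ ∘ suc)))

  hsum-tail : ∀ d {φ} → φ 0 ≡ 0 → hsum (suc d) φ ≡ z * hsum d (φ ∘ suc)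
  hsum-tail d {φ} φ≡0 = trans (cong (λ k → w ^ suc d * ι k + z * hsum d (φ ∘ suc)) φ≡0)
    (trans (cong (_+ z * hsum d (φ ∘ suc)) (zeroʳ (w ^ suc d))) (+-identityˡ _))

  -- If `p(0) = 0`, the series of `p(m)` is `z` times the series of `p(m + 1)`.
  hsum-shift : ∀ d {φ} → φ 0 ≡ 0 → φ (suc d) ≡ 0 → hsum d φ ≡ z * hsum d (shift φ)
  hsum-shift d {φ} φ0≡0 φd≡0 = begin
    hsum d φ                                   ≡⟨ split (hsum d φ) ⟩
    z * hsum d φ + w * hsum d φ                ≡⟨ cong (z * hsum d φ +_) (hsum-suc d {φ} φd≡0) ⟨
    z * hsum d φ + hsum (suc d) φ              ≡⟨ cong (z * hsum d φ +_) (hsum-tail d {φ} φ0≡0) ⟩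
    z * hsum d φ + z * hsum d (φ ∘ suc)        ≡⟨ distribˡ z _ _ ⟨
    z * (hsum d φ + hsum d (φ ∘ suc))          ≡⟨ cong (z *_) (hsum-+ d φ (φ ∘ suc)) ⟨
    z * hsum d (shift φ)                       ∎
    where open ≡-Reasoning

  sumTo : ℕ → (ℕ → A) → A
  sumTo zero    u = 0#
  sumTo (suc n) u = u 0 + sumTo n (u ∘ suc)

  sumTo-cong : ∀ n {u v} → u ≗ v → sumTo n u ≡ sumTo n v
  sumTo-cong zero    u≗v = refl
  sumTo-cong (suc n) u≗v = cong₂ _+_ (u≗v 0) (sumTo-cong n (u≗v ∘ suc))

  sumTo-suc : ∀ n u → sumTo (suc n) u ≡ sumTo n u + u n
  sumTo-suc zero    u = +-comm (u 0) 0#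
  sumTo-suc (suc n) u = trans (cong (u 0 +_) (sumTo-suc n (u ∘ suc))) (sym (+-assoc (u 0) _ _))

  -- u 0 + ⋯ + u (k - 1) + z (u k + ⋯ + u (k + m - 1))
  mix : ℕ → ℕ → (ℕ → A) → A
  mix zero    m u = z * sumTo m u
  mix (suc k) m u = u 0 + mix k m (u ∘ suc)

  -- Moving `u k` out of the part weighted by `z` raises its weight by `1 - z = w`. Numerators
  -- change by the same amount when a factor `2m` becomes `2m + 1`, or `2m + 1` becomes `2m + 2`.
  mix-suc : ∀ k m u → mix (suc k) m u ≡ mix k (suc m) u + w * u k
  mix-suc zero m u = trans (cong (_+ z * sumTo m (u ∘ suc)) (split (u 0)))
    (solve 4 (λ z w a s → (z :* a :+ w :* a) :+ z :* s := z :* (a :+ s) :+ w :* a) refl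
      z w (u 0) (sumTo m (u ∘ suc)))
  mix-suc (suc k) m u = trans (cong (u 0 +_) (mix-suc k m (u ∘ suc)))
    (sym (+-assoc (u 0) _ _))

  mix-all : ∀ n u → mix n 0 u ≡ sumTo n u
  mix-all zero    u = zeroʳ z
  mix-all (suc n) u = cong (u 0 +_) (mix-all n (u ∘ suc))

  size : ℕ → ℕ
  size d = suc d ℕ.+ suc d

  -- The values at z of the h-polynomials of (2m)^(d-i) (2m+1)^i for i ≤ d, followed by
  -- those of (2m+1)^(d-i) (2m+2)^i for i ≤ d.
  family : ℕ → ℕ → A
  family zero    i = 1#
  family (suc d) i = mix (skip (suc d) i) (size d ∸ skip (suc d) i) (family d)

  family-mix : ∀ d i {k m} → skip (suc d) i ≡ k → k ℕ.+ m ≡ size d →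
               family (suc d) i ≡ mix k m (family d)
  family-mix d i {k} {m} refl k+m≡n =
    cong (λ r → mix k r (family d)) (trans (cong (_∸ k) (sym k+m≡n)) (ℕ.m+n∸m≡n k m))

  mix-sumTo : ∀ k m u → mix k m u ≡ sumTo k u + z * sumTo m (λ i → u (i ℕ.+ k))
  mix-sumTo zero    m u = trans (cong (z *_) (sumTo-cong m (λ i → cong u (sym (ℕ.+-identityʳ i)))))
                                (sym (+-identityˡ _))
  mix-sumTo (suc k) m u = trans (cong (u 0 +_) (trans (mix-sumTo k m (u ∘ suc))
      (cong (λ s → sumTo k (u ∘ suc) + z * s) (sumTo-cong m (λ i → cong u (sym (ℕ.+-suc i k)))))))
    (sym (+-assoc (u 0) _ _))

  sumTo-+ : ∀ m r u → sumTo (m ℕ.+ r) u ≡ sumTo m u + sumTo r (λ i → u (i ℕ.+ m))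
  sumTo-+ zero    r u = trans (sumTo-cong r (λ i → cong u (sym (ℕ.+-identityʳ i)))) (sym (+-identityˡ _))
  sumTo-+ (suc m) r u = trans (cong (u 0 +_) (trans (sumTo-+ m r (u ∘ suc))
      (cong (sumTo m (u ∘ suc) +_) (sumTo-cong r (λ i → cong u (sym (ℕ.+-suc i m)))))))
    (sym (+-assoc (u 0) _ _))

  sumTo-* : ∀ a n u → sumTo n (λ i → a * u i) ≡ a * sumTo n u
  sumTo-* a zero    u = sym (zeroʳ a)
  sumTo-* a (suc n) u = trans (cong (a * u 0 +_) (sumTo-* a n (u ∘ suc))) (sym (distribˡ a (u 0) _))

  private
    segment : ℕ → ℕ → (ℕ → A) → A
    segment k m u = sumTo m (λ i → u (i ℕ.+ k))

  -- Two members of the next level share the bracket and differ only in the weight of the middle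
  -- segment, `z` here and 1 in `mix-right`. This is the shape in which their arguments are
  -- compared.
  mix-left : ∀ k m r u → mix k (m ℕ.+ r) u
           ≡ (sumTo k u + z * segment (m ℕ.+ k) r u) + z * segment k m u
  mix-left k m r u = trans (mix-sumTo k (m ℕ.+ r) u)
    (trans (cong (λ s → sumTo k u + z * s) (trans (sumTo-+ m r (λ i → u (i ℕ.+ k)))
       (cong (segment k m u +_) (sumTo-cong r (λ i → cong u (ℕ.+-assoc i m k))))))
      (solve 4 (λ a b c z → a :+ z :* (b :+ c) := (a :+ z :* c) :+ z :* b) refl
        (sumTo k u) (segment k m u) (segment (m ℕ.+ k) r u) z))

  mix-right : ∀ k m r u → mix (k ℕ.+ m) r u
            ≡ (sumTo k u + z * segment (m ℕ.+ k) r u) + segment k m u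
  mix-right k m r u = trans (mix-sumTo (k ℕ.+ m) r u)
    (trans (cong₂ (λ s t → s + z * t) (sumTo-+ k m u) (cong (λ n → segment n r u) (ℕ.+-comm k m)))
      (solve 4 (λ a b c z → (a :+ b) :+ z :* c := (a :+ z :* c) :+ b) refl
        (sumTo k u) (segment k m u) (segment (m ℕ.+ k) r u) z))

  eulerian : ℕ → A
  eulerian d = hsum d (λ j → cubeChains j (wholes d))

  -- What remains of `eulerian (suc d)` once the members `d` and `d + 1`, both equal to
  -- `eulerian d`, are taken out with weights 1 and `z`. It is the overview's `T` in dimension
  -- `d + 1`.
  side : ℕ → A
  side d = sumTo d (family d) + z * sumTo d (λ i → family d (i ℕ.+ suc (suc d)))

  module _ (+-cancelˡ : ∀ a {b c} → a + b ≡ a + c → b ≡ c)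
           (w-cancelˡ : ∀ {a b} → w * a ≡ w * b → a ≡ b) where

    private
      Low High : ℕ → Set
      Low  d = ∀ p q → p ℕ.+ q ≡ d → family d q ≡ hsum d (lowPower p q)
      High d = ∀ q r → q ℕ.+ r ≡ d → family d (r ℕ.+ suc d) ≡ hsum d (highPower q r)

    module Level (d : ℕ) (low : Low d) (high : High d) where

      private
        u : ℕ → A
        u = family d
        first last : A
        first = hsum (suc d) (lowPower (suc d) 0)
        last  = hsum (suc d) (highPower 0 (suc d))

      hsum-2m+1· : ∀ φ → VanishesAbove d φ → hsum (suc d) (2m+1· φ) ≡ hsum (suc d) (2m· φ) + w * hsum d φ
      hsum-2m+1· φ van = trans (hsum-+ (suc d) (2m· φ) φ) (cong (hsum (suc d) (2m· φ) +_) (hsum-suc d {φ} (van ℕ.≤-refl)))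

      hsum-2m+2· : ∀ φ → VanishesAbove d φ → hsum (suc d) (2m+2· φ) ≡ hsum (suc d) (2m+1· φ) + w * hsum d φ
      hsum-2m+2· φ van = trans (hsum-+ (suc d) (2m+1· φ) φ) (cong (hsum (suc d) (2m+1· φ) +_) (hsum-suc d {φ} (van ℕ.≤-refl)))

      step : ∀ {φ} k m {e e′} → mix k (suc m) u + first ≡ mix 0 (size d) u + e →
             e′ ≡ e + w * hsum d φ → u k ≡ hsum d φ →
             mix (suc k) m u + first ≡ mix 0 (size d) u + e′
      step {φ} k m {e} {e′} ih e′≡ uk≡ = begin
        mix (suc k) m u + first                    ≡⟨ cong (_+ first) (mix-suc k m u) ⟩
        mix k (suc m) u + w * u k + first          ≡⟨ solve 3 (λ a b c → a :+ b :+ c := a :+ c :+ b) refl _ _ _ ⟩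
        mix k (suc m) u + first + w * u k          ≡⟨ cong₂ (λ a b → a + w * b) ih uk≡ ⟩
        mix 0 (size d) u + e + w * hsum d φ        ≡⟨ +-assoc _ e _ ⟩
        mix 0 (size d) u + (e + w * hsum d φ)      ≡⟨ cong (mix 0 (size d) u +_) e′≡ ⟨
        mix 0 (size d) u + e′                      ∎
        where open ≡-Reasoning

      -- `mix` and the numerators grow by the same increments, so their difference is constant along
      -- the family. Adding the initial value of each to the other side says this without
      -- subtraction.
      low-mix : ∀ q p m → p ℕ.+ q ≡ suc d → q ℕ.+ m ≡ size d →
                mix q m u + first ≡ mix 0 (size d) u + hsum (suc d) (lowPower p q)
      low-mix zero p m p+0≡ refl with refl ← trans (sym (ℕ.+-identityʳ p)) p+0≡ = refl
      low-mix (suc q) p m p+q≡ q+m≡ = step q m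
        (low-mix q (suc p) (suc m) (trans (sym (ℕ.+-suc p q)) p+q≡) (trans (ℕ.+-suc q m) q+m≡))
        (trans (sym (hsum-cong (suc d) (lowPower-suc p q)))
               (hsum-2m+1· (lowPower p q) (subst (λ n → VanishesAbove n (lowPower p q)) p+q≡d (vanishes-lowPower p q))))
        (low p q p+q≡d)
        where
        p+q≡d : p ℕ.+ q ≡ d
        p+q≡d = ℕ.suc-injective (trans (sym (ℕ.+-suc p q)) p+q≡)

      high-mix : ∀ r q m → q ℕ.+ r ≡ suc d → r ℕ.+ suc d ℕ.+ m ≡ size d →
                 mix (r ℕ.+ suc d) m u + first ≡ mix 0 (size d) u + hsum (suc d) (highPower q r)
      -- The second half starts where the first ended, since both contain `(2m+1)^(d+1)`.
      high-mix zero q m q+0≡ n≡ with refl ← trans (sym (ℕ.+-identityʳ q)) q+0≡ =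
        trans (low-mix (suc d) 0 m refl n≡)
              (cong (mix 0 (size d) u +_) (hsum-cong (suc d) (lowPower≗highPower (suc d))))
      high-mix (suc r) q m q+r≡ n≡ = step (r ℕ.+ suc d) m
        (high-mix r (suc q) (suc m) (trans (sym (ℕ.+-suc q r)) q+r≡) (trans (ℕ.+-suc (r ℕ.+ suc d) m) n≡))
        (trans (sym (hsum-cong (suc d) (highPower-suc q r)))
               (hsum-2m+2· (highPower q r) (subst (λ n → VanishesAbove n (highPower q r)) q+r≡d (vanishes-highPower q r))))
        (high q r q+r≡d)
        where
        q+r≡d : q ℕ.+ r ≡ d
        q+r≡d = ℕ.suc-injective (trans (sym (ℕ.+-suc q r)) q+r≡)

      -- `(2m)^(d+1)` vanishes at `m = 0` and turns into `(2m+2)^(d+1)` when `m` is replaced by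
      -- `m + 1`.
      first≡z*last : first ≡ z * last
      first≡z*last = trans
        (hsum-shift (suc d) {lowPower (suc d) 0} refl
          (vanishes-lowPower (suc d) 0 (s≤s (ℕ.≤-reflexive (cong suc (ℕ.+-identityʳ d))))))
        (cong (z *_) (hsum-cong (suc d) (shift-lowPower (suc d))))

      -- Both ends of the family at level d + 1 satisfy first = z * last, and their
      -- differences agree; cancelling 1 - z identifies them.
      sumTo≡last : sumTo (size d) u ≡ last
      sumTo≡last = w-cancelˡ (+-cancelˡ (z * s + z * last) (begin
        z * s + z * last + w * s        ≡⟨ solve 3 (λ a b c → a :+ b :+ c := a :+ c :+ b) refl (z * s) (z * last) (w * s) ⟩
        z * s + w * s + z * last        ≡⟨ cong₂ _+_ (split s) first≡z*last ⟨
        s + first                       ≡⟨ cong (_+ first) (mix-all (size d) u) ⟨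
        mix (size d) 0 u + first        ≡⟨ high-mix (suc d) 0 0 refl (ℕ.+-identityʳ (size d)) ⟩
        z * s + last                    ≡⟨ cong (z * s +_) (split last) ⟩
        z * s + (z * last + w * last)   ≡⟨ +-assoc (z * s) (z * last) (w * last) ⟨
        z * s + z * last + w * last     ∎))
        where
        open ≡-Reasoning
        s : A
        s = sumTo (size d) u

      -- By `sumTo≡last`, `mix 0 (size d) u` is `z * last`, that is `first`: the constant difference
      -- is zero.
      cancel-first : ∀ {a b} → a + first ≡ mix 0 (size d) u + b → a ≡ b
      cancel-first {a} {b} eq = +-cancelˡ first (trans (+-comm first a) (trans eq
        (cong (_+ b) (trans (cong (z *_) sumTo≡last) (sym first≡z*last)))))

    family-low  : ∀ d → Low d
    family-high : ∀ d → High d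
    family-low zero    zero zero refl = sym (+-identityʳ 1#)
    family-low (suc d) p q p+q≡ = trans
      (family-mix d q (skip-≤ q≤) (ℕ.m+[n∸m]≡n (ℕ.≤-trans q≤ (ℕ.m≤m+n (suc d) (suc d)))))
      (cancel-first (low-mix q p _ p+q≡ (ℕ.m+[n∸m]≡n (ℕ.≤-trans q≤ (ℕ.m≤m+n (suc d) (suc d))))))
      where
      open Level d (family-low d) (family-high d)
      q≤ : q ≤ suc d
      q≤ = subst (q ≤_) p+q≡ (ℕ.m≤n+m q p)
    family-high zero    zero zero refl = sym (+-identityʳ 1#)
    family-high (suc d) q r q+r≡ = trans
      (family-mix d (r ℕ.+ suc (suc d)) (skip-> (suc d) r) (ℕ.m+[n∸m]≡n r+≤))
      (cancel-first (high-mix r q _ q+r≡ (ℕ.m+[n∸m]≡n r+≤)))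
      where
      open Level d (family-low d) (family-high d)
      r+≤ : r ℕ.+ suc d ≤ size d
      r+≤ = ℕ.+-monoˡ-≤ (suc d) (subst (r ≤_) q+r≡ (ℕ.m≤n+m r q))

    eulerian-low : ∀ d → family d d ≡ eulerian d
    eulerian-low d = trans (family-low d 0 d refl) (sym (hsum-cong d (cubeChains≗lowPower d)))

    eulerian-high : ∀ d → family d (suc d) ≡ eulerian d
    eulerian-high d = trans (family-high d d 0 (ℕ.+-identityʳ d))
      (sym (hsum-cong d (λ j → trans (cubeChains≗lowPower d j) (lowPower≗highPower d j))))

    -- The middle member of level `d + 1` cuts level `d` exactly between its two copies of
    -- `eulerian d`, so one of them gets the weight 1 and the other `z`.
    eulerian-suc : ∀ d → eulerian (suc d) ≡ (1# + z) * eulerian d + side d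
    eulerian-suc d = begin
      eulerian (suc d)
        ≡⟨ eulerian-low (suc d) ⟨
      family (suc d) (suc d)
        ≡⟨ family-mix d (suc d) {suc d} {suc d} (skip-≤ {suc d} ℕ.≤-refl) refl ⟩
      mix (suc d) (suc d) u
        ≡⟨ mix-sumTo (suc d) (suc d) u ⟩
      sumTo (suc d) u + z * sumTo (suc d) (λ i → u (i ℕ.+ suc d))
        ≡⟨ cong₂ (λ a b → a + z * b)
             (trans (sumTo-suc d u) (cong (sumTo d u +_) (eulerian-low d)))
             (cong₂ _+_ (eulerian-high d) (sumTo-cong d (λ i → cong u (sym (ℕ.+-suc i (suc d)))))) ⟩
      (sumTo d u + eulerian d) + z * (eulerian d + sumTo d (λ i → u (i ℕ.+ suc (suc d))))
        ≡⟨ solve 4 (λ s b z t → (s :+ b) :+ z :* (b :+ t) := (con 1 :+ z) :* b :+ (s :+ z :* t)) refl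
             (sumTo d u) (eulerian d) z (sumTo d (λ i → u (i ℕ.+ suc (suc d)))) ⟩
      (1# + z) * eulerian d + side d ∎
      where
      open ≡-Reasoning
      u : ℕ → A
      u = family d

    -- `overcount d` is `(2x + 1) f` for the boundary of the d-cube. In the numerator `x` becomes
    -- `z` and the raised degree gives `w`, so the factor is `2z + w = 1 + z`.
    hsum-overcount : ∀ d → hsum (suc d) (overcount d) ≡ (1# + z) * eulerian d
    hsum-overcount d = begin
      hsum (suc d) (overcount d)
        ≡⟨ hsum-cong (suc d) {overcount d} {λ j → before j ℕ.+ (before j ℕ.+ c j)}
             (λ { zero → refl ; (suc j) → double-+ (c j) (c (suc j)) }) ⟩
      hsum (suc d) (λ j → before j ℕ.+ (before j ℕ.+ c j))
        ≡⟨ trans (hsum-+ (suc d) before (λ j → before j ℕ.+ c j)) (cong (hsum (suc d) before +_) (hsum-+ (suc d) before c)) ⟩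
      hsum (suc d) before + (hsum (suc d) before + hsum (suc d) c)
        ≡⟨ cong₂ (λ a b → a + (a + b)) (hsum-tail d {before} refl) (hsum-suc d {c}
             (trans (cubeChains≗lowPower d (suc d)) (vanishes-lowPower 0 d ℕ.≤-refl))) ⟩
      z * eulerian d + (z * eulerian d + w * eulerian d)
        ≡⟨ cong (z * eulerian d +_) (split (eulerian d)) ⟨
      z * eulerian d + eulerian d
        ≡⟨ solve 2 (λ z b → z :* b :+ b := (con 1 :+ z) :* b) refl z (eulerian d) ⟩
      (1# + z) * eulerian d ∎
      where
      open ≡-Reasoning
      c before : ℕ → ℕ
      c j = cubeChains j (wholes d)
      before zero    = 0
      before (suc j) = c j

    -- The corrections along the shared facets stand on the left because the semiring has no
    -- subtraction.
    f-polynomial-capped : ∀ {N d ℓ} {𝒫 : PolytopalComplex N} → CappedCubical (suc d) ℓ 𝒫 →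
      hsum (suc d) (f-vector (sd 𝒫)) + ι ℓ * ((1# + z) * eulerian d) ≡ ι (suc ℓ) * eulerian (suc d)
    f-polynomial-capped {d = d} {𝒫 = 𝒫} (cube isCube) = trans
      (cong₂ _+_ (hsum-cong (suc d) (CubeBoundary.f-sd-cube 𝒫 isCube)) (zeroˡ _))
      (solve 1 (λ b → b :+ con 0 := (con 1 :+ con 0) :* b) refl (eulerian (suc d)))
    f-polynomial-capped {d = d} {suc ℓ} {𝒫} (cap {𝒬 = 𝒬} capped𝒬 isCapping)
      with d , refl , f≡ ← f-sd-capping isCapping = begin
      hsum (suc d) (f-vector (sd 𝒫)) + ι (suc ℓ) * b
        ≡⟨ solve 3 (λ p l b → p :+ (con 1 :+ l) :* b := p :+ b :+ l :* b) refl _ (ι ℓ) b ⟩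
      hsum (suc d) (f-vector (sd 𝒫)) + b + ι ℓ * b
        ≡⟨ cong (λ s → hsum (suc d) (f-vector (sd 𝒫)) + s + ι ℓ * b) (hsum-overcount d) ⟨
      hsum (suc d) (f-vector (sd 𝒫)) + hsum (suc d) (overcount d) + ι ℓ * b
        ≡⟨ cong (_+ ι ℓ * b) (trans (sym (hsum-+ (suc d) (f-vector (sd 𝒫)) (overcount d)))
             (trans (hsum-cong (suc d) {λ j → f-vector (sd 𝒫) j ℕ.+ overcount d j}
                                        {λ j → f-vector (sd 𝒬) j ℕ.+ cubeChains j (wholes (suc d))}
                                        (λ { zero → refl ; (suc j) → f≡ j }))
                    (hsum-+ (suc d) (f-vector (sd 𝒬)) (λ j → cubeChains j (wholes (suc d)))))) ⟩
      hsum (suc d) (f-vector (sd 𝒬)) + eulerian (suc d) + ι ℓ * b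
        ≡⟨ solve 3 (λ q e l → q :+ e :+ l := e :+ (q :+ l)) refl _ (eulerian (suc d)) (ι ℓ * b) ⟩
      eulerian (suc d) + (hsum (suc d) (f-vector (sd 𝒬)) + ι ℓ * b)
        ≡⟨ cong (eulerian (suc d) +_) (f-polynomial-capped capped𝒬) ⟩
      eulerian (suc d) + ι (suc ℓ) * eulerian (suc d)
        ≡⟨ solve 2 (λ e l → e :+ l :* e := (con 1 :+ l) :* e) refl (eulerian (suc d)) (ι (suc ℓ)) ⟩
      ι (suc (suc ℓ)) * eulerian (suc d) ∎
      where
      open ≡-Reasoning
      b : A
      b = (1# + z) * eulerian d

    h-polynomial-capped : ∀ {N d ℓ} {𝒫 : PolytopalComplex N} → CappedCubical (suc d) ℓ 𝒫 →
      hsum (suc d) (f-vector (sd 𝒫)) ≡ (1# + z) * eulerian d + ι (suc ℓ) * side d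
    h-polynomial-capped {d = d} {ℓ} {𝒫} capped = +-cancelˡ (ι ℓ * b) (begin
      ι ℓ * b + hsum (suc d) (f-vector (sd 𝒫))        ≡⟨ +-comm (ι ℓ * b) _ ⟩
      hsum (suc d) (f-vector (sd 𝒫)) + ι ℓ * b        ≡⟨ f-polynomial-capped capped ⟩
      ι (suc ℓ) * eulerian (suc d)                    ≡⟨ cong (ι (suc ℓ) *_) (eulerian-suc d) ⟩
      (1# + ι ℓ) * (b + side d)
        ≡⟨ solve 3 (λ l b s → (con 1 :+ l) :* (b :+ s) := l :* b :+ (b :+ (con 1 :+ l) :* s)) refl (ι ℓ) b (side d) ⟩
      ι ℓ * b + (b + ι (suc ℓ) * side d)              ∎)
      where
      open ≡-Reasoning
      b : A
      b = (1# + z) * eulerian d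

  -- Evaluation of integer polynomials and of `h`.

  module Evaluation (ρ : ℤ → A) (ρ-0 : ρ (pos 0) ≡ 0#) (ρ-1 : ρ (pos 1) ≡ 1#)
    (ρ-+ : ∀ i j → ρ (i ℤ.+ j) ≡ ρ i + ρ j) (ρ-* : ∀ i j → ρ (i ℤ.* j) ≡ ρ i * ρ j) where

    evaluate : Poly ℤ → A
    evaluate []      = 0#
    evaluate (a ∷ p) = ρ a + z * evaluate p

    ρ-ι : ∀ n → ρ (pos n) ≡ ι n
    ρ-ι zero    = ρ-0
    ρ-ι (suc n) = trans (ρ-+ (pos 1) (pos n)) (cong₂ _+_ ρ-1 (ρ-ι n))

    evaluate-⊕ : ∀ p q → evaluate (p ⊕ q) ≡ evaluate p + evaluate q
    evaluate-⊕ []      q       = sym (+-identityˡ _)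
    evaluate-⊕ (a ∷ p) []      = sym (+-identityʳ _)
    evaluate-⊕ (a ∷ p) (b ∷ q) = trans
      (cong₂ (λ s t → s + z * t) (ρ-+ a b) (evaluate-⊕ p q))
      (solve 5 (λ a b z p q → (a :+ b) :+ z :* (p :+ q) := (a :+ z :* p) :+ (b :+ z :* q)) refl
        (ρ a) (ρ b) z (evaluate p) (evaluate q))

    evaluate-map : ∀ a q → evaluate (map (a ℤ.*_) q) ≡ ρ a * evaluate q
    evaluate-map a []      = sym (zeroʳ (ρ a))
    evaluate-map a (b ∷ q) = trans
      (cong₂ (λ s t → s + z * t) (ρ-* a b) (evaluate-map a q))
      (solve 4 (λ a b z q → a :* b :+ z :* (a :* q) := a :* (b :+ z :* q)) refl (ρ a) (ρ b) z (evaluate q))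

    evaluate-⊛ : ∀ p q → evaluate (p ⊛ q) ≡ evaluate p * evaluate q
    evaluate-⊛ []      q = sym (zeroˡ _)
    evaluate-⊛ (a ∷ p) q = trans (evaluate-⊕ (map (a ℤ.*_) q) (pos 0 ∷ (p ⊛ q)))
      (trans (cong₂ _+_ (evaluate-map a q) (cong₂ (λ s t → s + z * t) ρ-0 (evaluate-⊛ p q)))
        (solve 4 (λ a z p q → a :* q :+ (con 0 :+ z :* (p :* q)) := (a :+ z :* p) :* q) refl
          (ρ a) z (evaluate p) (evaluate q)))

    evaluate-constant : ∀ a → evaluate (constant a) ≡ ρ a
    evaluate-constant a = trans (cong (ρ a +_) (zeroʳ z)) (+-identityʳ (ρ a))

    evaluate-^ₚ : ∀ p n → evaluate (p ^ₚ n) ≡ evaluate p ^ n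
    evaluate-^ₚ p zero    = trans (evaluate-constant (pos 1)) ρ-1
    evaluate-^ₚ p (suc n) = trans (evaluate-⊛ p (p ^ₚ n)) (cong (evaluate p *_) (evaluate-^ₚ p n))

    evaluate-X : evaluate X ≡ z
    evaluate-X = trans (cong₂ (λ a b → a + z * (b + z * 0#)) ρ-0 ρ-1)
      (solve 1 (λ z → con 0 :+ z :* (con 1 :+ z :* con 0) := z) refl z)

    -- The image of -1 is known only through `1 + ρ(-1) = 0`. Writing the constant term as `z + w`
    -- supplies the `z` that cancels against `z ρ(-1)`.
    evaluate-1-X : evaluate 1-X ≡ w
    evaluate-1-X = begin
      ρ (pos 1) + z * (r + z * 0#)   ≡⟨ cong (_+ z * (r + z * 0#)) (trans ρ-1 (sym z+w≡1)) ⟩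
      z + w + z * (r + z * 0#)     ≡⟨ solve 3 (λ z w r → z :+ w :+ z :* (r :+ z :* con 0) := w :+ z :* (con 1 :+ r)) refl z w r ⟩
      w + z * (1# + r)             ≡⟨ cong (λ a → w + z * (a + r)) ρ-1 ⟨
      w + z * (ρ (pos 1) + r)        ≡⟨ cong (λ a → w + z * a) (trans (sym (ρ-+ (pos 1) -[1+ 0 ])) ρ-0) ⟩
      w + z * 0#                   ≡⟨ trans (cong (w +_) (zeroʳ z)) (+-identityʳ w) ⟩
      w                            ∎
      where
      open ≡-Reasoning
      r : A
      r = ρ -[1+ 0 ]

    evaluate-sum : ∀ (f : ℕ → Poly ℤ) (g : ℕ → ℕ) n →
      evaluate (foldr _⊕_ [] (map f (applyUpTo g n))) ≡ sumTo n (evaluate ∘ f ∘ g)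
    evaluate-sum f g zero    = refl
    evaluate-sum f g (suc n) = trans (evaluate-⊕ (f (g 0)) _)
      (cong (evaluate (f (g 0)) +_) (evaluate-sum f (g ∘ suc) n))

    hsum-sumTo : ∀ m φ → sumTo (suc m) (λ j → ι (φ j) * (z ^ j * w ^ (m ∸ j))) ≡ hsum m φ
    hsum-sumTo zero    φ = solve 1 (λ a → a :* (con 1 :* con 1) :+ con 0 := a) refl (ι (φ 0))
    hsum-sumTo (suc m) φ = cong₂ _+_
      (solve 2 (λ a p → a :* (con 1 :* p) := p :* a) refl (ι (φ 0)) (w ^ suc m))
      (trans (sumTo-cong (suc m) (λ j → solve 4 (λ a z p q → a :* (z :* p :* q) := z :* (a :* (p :* q))) refl
                (ι (φ (suc j))) z (z ^ j) (w ^ (m ∸ j))))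
        (trans (sumTo-* z (suc m) (λ j → ι (φ (suc j)) * (z ^ j * w ^ (m ∸ j))))
          (cong (z *_) (hsum-sumTo m (φ ∘ suc)))))

    evaluate-h : ∀ m φ → evaluate (h m φ) ≡ hsum m φ
    evaluate-h m φ = trans
      (evaluate-sum (λ j → constant (pos (φ j)) ⊛ (X ^ₚ j ⊛ 1-X ^ₚ (m ∸ j))) (λ j → j) (suc m))
      (trans (sumTo-cong (suc m) (λ j → trans (evaluate-⊛ (constant (pos (φ j))) (X ^ₚ j ⊛ 1-X ^ₚ (m ∸ j)))
          (cong₂ _*_ (trans (evaluate-constant (pos (φ j))) (ρ-ι (φ j)))
            (trans (evaluate-⊛ (X ^ₚ j) (1-X ^ₚ (m ∸ j)))
              (cong₂ _*_ (trans (evaluate-^ₚ X j) (cong (_^ j) evaluate-X))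
                         (trans (evaluate-^ₚ 1-X (m ∸ j)) (cong (_^ (m ∸ j)) evaluate-1-X)))))))
        (hsum-sumTo m φ))

-- Gaussian rationals and inequalities over `ℚ`.

open ℚ.+-*-Solver
open RawSemiringOps ℚ.+-*-rawSemiring using (_^_)

𝔾 : Set
𝔾 = ℚ × ℚ

infixl 6 _+ᵍ_
infixl 7 _*ᵍ_

_+ᵍ_ _*ᵍ_ : 𝔾 → 𝔾 → 𝔾
(a , b) +ᵍ (c , d) = a ℚ.+ c , b ℚ.+ d
(a , b) *ᵍ (c , d) = a ℚ.* c ℚ.- b ℚ.* d , a ℚ.* d ℚ.+ b ℚ.* c

0ᵍ 1ᵍ : 𝔾
0ᵍ = 0ℚ , 0ℚ
1ᵍ = 1ℚ , 0ℚ

𝔾-isCommutativeSemiring : IsCommutativeSemiring _≡_ _+ᵍ_ _*ᵍ_ 0ᵍ 1ᵍ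
𝔾-isCommutativeSemiring = isCommutativeSemiringˡ record
  { +-isCommutativeMonoid = isCommutativeMonoidˡ record
    { isSemigroup = record
      { isMagma = record { isEquivalence = isEquivalence ; ∙-cong = cong₂ _+ᵍ_ }
      ; assoc   = λ (a , b) (c , d) (e , f) → cong₂ _,_ (ℚ.+-assoc a c e) (ℚ.+-assoc b d f)
      }
    ; identityˡ = λ (a , b) → cong₂ _,_ (ℚ.+-identityˡ a) (ℚ.+-identityˡ b)
    ; comm      = λ (a , b) (c , d) → cong₂ _,_ (ℚ.+-comm a c) (ℚ.+-comm b d)
    }
  ; *-isCommutativeMonoid = isCommutativeMonoidˡ record
    { isSemigroup = record
      { isMagma = record { isEquivalence = isEquivalence ; ∙-cong = cong₂ _*ᵍ_ }
      ; assoc   = λ (a , b) (c , d) (e , f) → cong₂ _,_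
          (solve 6 (λ a b c d e f → (a :* c :- b :* d) :* e :- (a :* d :+ b :* c) :* f
                                 := a :* (c :* e :- d :* f) :- b :* (c :* f :+ d :* e)) refl a b c d e f)
          (solve 6 (λ a b c d e f → (a :* c :- b :* d) :* f :+ (a :* d :+ b :* c) :* e
                                 := a :* (c :* f :+ d :* e) :+ b :* (c :* e :- d :* f)) refl a b c d e f)
      }
    ; identityˡ = λ (a , b) → cong₂ _,_
          (solve 2 (λ a b → con 1ℚ :* a :- con 0ℚ :* b := a) refl a b)
          (solve 2 (λ a b → con 1ℚ :* b :+ con 0ℚ :* a := b) refl a b)
    ; comm      = λ (a , b) (c , d) → cong₂ _,_
          (solve 4 (λ a b c d → a :* c :- b :* d := c :* a :- d :* b) refl a b c d)
          (solve 4 (λ a b c d → a :* d :+ b :* c := c :* b :+ d :* a) refl a b c d)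
    }
  ; distribʳ = λ (a , b) (c , d) (e , f) → cong₂ _,_
      (solve 6 (λ a b c d e f → (c :+ e) :* a :- (d :+ f) :* b := (c :* a :- d :* b) :+ (e :* a :- f :* b)) refl a b c d e f)
      (solve 6 (λ a b c d e f → (c :+ e) :* b :+ (d :+ f) :* a := (c :* b :+ d :* a) :+ (e :* b :+ f :* a)) refl a b c d e f)
  ; zeroˡ = λ (a , b) → cong₂ _,_
      (solve 2 (λ a b → con 0ℚ :* a :- con 0ℚ :* b := con 0ℚ) refl a b)
      (solve 2 (λ a b → con 0ℚ :* b :+ con 0ℚ :* a := con 0ℚ) refl a b)
  }

+ᵍ-cancelˡ : ∀ a {b c} → a +ᵍ b ≡ a +ᵍ c → b ≡ c
+ᵍ-cancelˡ (a₁ , a₂) {b} {c} eq = cong₂ _,_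
  (∙-cancelˡ a₁ (proj₁ b) (proj₁ c) (cong proj₁ eq))
  (∙-cancelˡ a₂ (proj₂ b) (proj₂ c) (cong proj₂ eq))
  where open Group ℚ.+-0-group using (∙-cancelˡ)

0≤p*p : ∀ p → 0ℚ ℚ.≤ p ℚ.* p
0≤p*p p with ℚ.≤-total 0ℚ p
... | inj₁ 0≤p = ℚ.nonNegative⁻¹ _ {{ℚ.nonNeg*nonNeg⇒nonNeg p {{ℚ.nonNegative 0≤p}} p {{ℚ.nonNegative 0≤p}}}}
... | inj₂ p≤0 = ℚ.nonNegative⁻¹ _ {{ℚ.nonPos*nonPos⇒nonPos p {{ℚ.nonPositive p≤0}} p {{ℚ.nonPositive p≤0}}}}

0≤* : ∀ {p q} → 0ℚ ℚ.≤ p → 0ℚ ℚ.≤ q → 0ℚ ℚ.≤ p ℚ.* q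
0≤* {p} {q} 0≤p 0≤q = ℚ.nonNegative⁻¹ _ {{ℚ.nonNeg*nonNeg⇒nonNeg p {{ℚ.nonNegative 0≤p}} q {{ℚ.nonNegative 0≤q}}}}

0≤+ : ∀ {p q} → 0ℚ ℚ.≤ p → 0ℚ ℚ.≤ q → 0ℚ ℚ.≤ p ℚ.+ q
0≤+ = ℚ.+-mono-≤

0<p*p : ∀ {p} → p ≢ 0ℚ → 0ℚ ℚ.< p ℚ.* p
0<p*p {p} p≢0 with ℚ.<-cmp 0ℚ p
... | tri< 0<p _ _ = *-pos 0<p 0<p
... | tri≈ _ 0≡p _ = contradiction (sym 0≡p) p≢0
... | tri> _ _ p<0 = ℚ.positive⁻¹ _ {{ℚ.neg*neg⇒pos p {{ℚ.negative p<0}} p {{ℚ.negative p<0}}}}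

*-cancelˡ-pos : ∀ {r p q} → 0ℚ ℚ.< r → r ℚ.* p ≡ r ℚ.* q → p ≡ q
*-cancelˡ-pos {r} 0<r eq = ℚ.≤-antisym
  (ℚ.*-cancelˡ-≤-pos r {{ℚ.positive 0<r}} (ℚ.≤-reflexive eq))
  (ℚ.*-cancelˡ-≤-pos r {{ℚ.positive 0<r}} (ℚ.≤-reflexive (sym eq)))

norm : 𝔾 → ℚ
norm (a , b) = a ℚ.* a ℚ.+ b ℚ.* b

0≤norm : ∀ a → 0ℚ ℚ.≤ norm a
0≤norm (a , b) = 0≤+ (0≤p*p a) (0≤p*p b)

-- Comparison of arguments and the lower bound at a fixed Gaussian rational.

module Cone (x y : ℚ) where

  z 1-z : 𝔾
  z   = x , y
  1-z = 1ℚ ℚ.- x , ℚ.- y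

  z+[1-z]≡1 : z +ᵍ 1-z ≡ 1ᵍ
  z+[1-z]≡1 = cong₂ _,_ (solve 1 (λ x → x :+ (con 1ℚ :- x) := con 1ℚ) refl x) (ℚ.+-inverseʳ y)

  open Interlacing 𝔾-isCommutativeSemiring z 1-z z+[1-z]≡1

  -- y Im(a b̄)
  cross : 𝔾 → 𝔾 → ℚ
  cross (a , b) (c , d) = y ℚ.* (b ℚ.* c ℚ.- a ℚ.* d)

  cross-+ˡ : ∀ a b c → cross (a +ᵍ b) c ≡ cross a c ℚ.+ cross b c
  cross-+ˡ (a , a′) (b , b′) (c , c′) = solve 7 (λ y a a′ b b′ c c′ →
    y :* ((a′ :+ b′) :* c :- (a :+ b) :* c′) := y :* (a′ :* c :- a :* c′) :+ y :* (b′ :* c :- b :* c′))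
    refl y a a′ b b′ c c′

  cross-+ʳ : ∀ a b c → cross a (b +ᵍ c) ≡ cross a b ℚ.+ cross a c
  cross-+ʳ (a , a′) (b , b′) (c , c′) = solve 7 (λ y a a′ b b′ c c′ →
    y :* (a′ :* (b :+ c) :- a :* (b′ :+ c′)) := y :* (a′ :* b :- a :* b′) :+ y :* (a′ :* c :- a :* c′))
    refl y a a′ b b′ c c′

  cross-zˡ-zʳ : ∀ a b → cross (z *ᵍ a) (z *ᵍ b) ≡ norm z ℚ.* cross a b
  cross-zˡ-zʳ (a , a′) (b , b′) = solve 6 (λ x y a a′ b b′ →
    y :* ((x :* a′ :+ y :* a) :* (x :* b :- y :* b′) :- (x :* a :- y :* a′) :* (x :* b′ :+ y :* b))
    := (x :* x :+ y :* y) :* (y :* (a′ :* b :- a :* b′))) refl x y a a′ b b′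

  cross-self : ∀ a → cross a a ≡ 0ℚ
  cross-self (a , a′) = solve 3 (λ y a a′ → y :* (a′ :* a :- a :* a′) := con 0ℚ) refl y a a′

  cross-z-self : ∀ a → cross (z *ᵍ a) a ≡ y ℚ.* y ℚ.* norm a
  cross-z-self (a , a′) = solve 4 (λ x y a a′ →
    y :* ((x :* a′ :+ y :* a) :* a :- (x :* a :- y :* a′) :* a′) := y :* y :* (a :* a :+ a′ :* a′)) refl x y a a′

  -- For y > 0 and a, b ≠ 0: arg b ≤ arg a ≤ arg (z b), with the arguments taken in
  -- [arg b, arg b + 2π).
  infix 4 _⊵_
  _⊵_ : 𝔾 → 𝔾 → Set
  a ⊵ b = 0ℚ ℚ.≤ cross a b × 0ℚ ℚ.≤ cross (z *ᵍ b) a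

  0≤cross-z-self : ∀ a → 0ℚ ℚ.≤ cross (z *ᵍ a) a
  0≤cross-z-self a = subst (0ℚ ℚ.≤_) (sym (cross-z-self a)) (0≤* (0≤p*p y) (0≤norm a))

  ⊵-refl : ∀ a → a ⊵ a
  ⊵-refl a = ℚ.≤-reflexive (sym (cross-self a)) , 0≤cross-z-self a

  0≤cross-+ˡ : ∀ a b c → 0ℚ ℚ.≤ cross a c → 0ℚ ℚ.≤ cross b c → 0ℚ ℚ.≤ cross (a +ᵍ b) c
  0≤cross-+ˡ a b c p q = subst (0ℚ ℚ.≤_) (sym (cross-+ˡ a b c)) (0≤+ p q)

  0≤cross-+ʳ : ∀ a b c → 0ℚ ℚ.≤ cross a b → 0ℚ ℚ.≤ cross a c → 0ℚ ℚ.≤ cross a (b +ᵍ c)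
  0≤cross-+ʳ a b c p q = subst (0ℚ ℚ.≤_) (sym (cross-+ʳ a b c)) (0≤+ p q)

  0≤cross-z : ∀ a b → 0ℚ ℚ.≤ cross a b → 0ℚ ℚ.≤ cross (z *ᵍ a) (z *ᵍ b)
  0≤cross-z a b p = subst (0ℚ ℚ.≤_) (sym (cross-zˡ-zʳ a b)) (0≤* (0≤norm z) p)

  open IsCommutativeSemiring 𝔾-isCommutativeSemiring using (distribˡ; distribʳ; zeroˡ; zeroʳ; *-identityˡ)

  0≤cross-z+ : ∀ a b c → 0ℚ ℚ.≤ cross (z *ᵍ a) c → 0ℚ ℚ.≤ cross (z *ᵍ b) c → 0ℚ ℚ.≤ cross (z *ᵍ (a +ᵍ b)) c
  0≤cross-z+ a b c p q = subst (λ s → 0ℚ ℚ.≤ cross s c) (sym (distribˡ z a b)) (0≤cross-+ˡ (z *ᵍ a) (z *ᵍ b) c p q)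

  ⊵-+ˡ : ∀ {a b c} → a ⊵ c → b ⊵ c → a +ᵍ b ⊵ c
  ⊵-+ˡ {a} {b} {c} (p , p′) (q , q′) = 0≤cross-+ˡ a b c p q , 0≤cross-+ʳ (z *ᵍ c) a b p′ q′

  ⊵-+ʳ : ∀ {a b c} → a ⊵ b → a ⊵ c → a ⊵ b +ᵍ c
  ⊵-+ʳ {a} {b} {c} (p , p′) (q , q′) = 0≤cross-+ʳ a b c p q , 0≤cross-z+ b c a p′ q′

  0⊵ : ∀ a → 0ᵍ ⊵ a
  0⊵ (a , a′) = ℚ.≤-reflexive (sym (solve 3 (λ y a a′ → y :* (con 0ℚ :* a :- con 0ℚ :* a′) := con 0ℚ) refl y a a′))
    , ℚ.≤-reflexive (sym (solve 3 (λ y b b′ → y :* (b′ :* con 0ℚ :- b :* con 0ℚ) := con 0ℚ) refl y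
        (proj₁ (z *ᵍ (a , a′))) (proj₂ (z *ᵍ (a , a′)))))

  ⊵0 : ∀ a → a ⊵ 0ᵍ
  ⊵0 a@(a₁ , a₂) = ℚ.≤-reflexive (sym (solve 3 (λ y a a′ → y :* (a′ :* con 0ℚ :- a :* con 0ℚ) := con 0ℚ) refl y a₁ a₂))
    , subst (λ s → 0ℚ ℚ.≤ cross s a) (sym (zeroʳ z))
        (ℚ.≤-reflexive (sym (solve 3 (λ y a a′ → y :* (con 0ℚ :* a :- con 0ℚ :* a′) := con 0ℚ) refl y a₁ a₂)))

  sumTo-⊵ : ∀ k {u b} → (∀ {i} → i < k → u i ⊵ b) → sumTo k u ⊵ b
  sumTo-⊵ zero    {b = b} u⊵b = 0⊵ b
  sumTo-⊵ (suc k) {u} {b} u⊵b = ⊵-+ˡ {u 0} {sumTo k (u ∘ suc)} {b} (u⊵b (s≤s z≤n)) (sumTo-⊵ k (u⊵b ∘ s≤s))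

  ⊵-sumTo : ∀ k {u a} → (∀ {i} → i < k → a ⊵ u i) → a ⊵ sumTo k u
  ⊵-sumTo zero    {a = a} a⊵u = ⊵0 a
  ⊵-sumTo (suc k) {u} {a} a⊵u = ⊵-+ʳ {a} {u 0} {sumTo k (u ∘ suc)} (a⊵u (s≤s z≤n)) (⊵-sumTo k (a⊵u ∘ s≤s))

  -- Both `a` and `z c` lie in the cone from `b` to `z b`, hence so does their sum `D`. Adding `z b`
  -- to `D` instead of `b` therefore turns the result forward, by at most the argument of `z`.
  ⊵-mix : ∀ a b c → a ⊵ b → b ⊵ c → (a +ᵍ z *ᵍ c) +ᵍ z *ᵍ b ⊵ (a +ᵍ z *ᵍ c) +ᵍ b
  ⊵-mix a b c (ab , zba) (bc , zcb) =
      0≤cross-+ˡ D (z *ᵍ b) (D +ᵍ b)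
        (0≤cross-+ʳ D D b (ℚ.≤-reflexive (sym (cross-self D))) 0≤Db)
        (0≤cross-+ʳ (z *ᵍ b) D b 0≤zbD (0≤cross-z-self b))
    , 0≤cross-z+ D b (D +ᵍ z *ᵍ b)
        (0≤cross-+ʳ (z *ᵍ D) D (z *ᵍ b) (0≤cross-z-self D) (0≤cross-z D b 0≤Db))
        (0≤cross-+ʳ (z *ᵍ b) D (z *ᵍ b) 0≤zbD (ℚ.≤-reflexive (sym (cross-self (z *ᵍ b)))))
    where
    D : 𝔾
    D = a +ᵍ z *ᵍ c
    0≤Db : 0ℚ ℚ.≤ cross D b
    0≤Db = 0≤cross-+ˡ a (z *ᵍ c) b ab zcb
    0≤zbD : 0ℚ ℚ.≤ cross (z *ᵍ b) D
    0≤zbD = 0≤cross-+ʳ (z *ᵍ b) a (z *ᵍ c) zba (0≤cross-z b c bc)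

  mix-⊵ : ∀ k m r u → (∀ {i j} → i ≤ j → j < k ℕ.+ (m ℕ.+ r) → u i ⊵ u j) →
          mix k (m ℕ.+ r) u ⊵ mix (k ℕ.+ m) r u
  mix-⊵ k m r u u⊵ = subst₂ _⊵_ (sym (mix-left k m r u)) (sym (mix-right k m r u))
    (⊵-mix (sumTo k u) (sumTo m (λ i → u (i ℕ.+ k))) (sumTo r (λ i → u (i ℕ.+ (m ℕ.+ k))))
      (sumTo-⊵ k λ {i} i<k → ⊵-sumTo m λ {j} j<m →
        u⊵ (ℕ.≤-trans (ℕ.<⇒≤ i<k) (ℕ.m≤n+m k j))
           (subst (j ℕ.+ k <_) (ℕ.+-comm (m ℕ.+ r) k) (ℕ.+-monoˡ-< k (ℕ.<-≤-trans j<m (ℕ.m≤m+n m r)))))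
      (sumTo-⊵ m λ {i} i<m → ⊵-sumTo r λ {j} j<r →
        u⊵ (ℕ.≤-trans (ℕ.+-monoˡ-≤ k (ℕ.<⇒≤ i<m)) (ℕ.m≤n+m (m ℕ.+ k) j))
           (subst (j ℕ.+ (m ℕ.+ k) <_) (reorder r) (ℕ.+-monoˡ-< (m ℕ.+ k) j<r))))
    where
    reorder : ∀ r → r ℕ.+ (m ℕ.+ k) ≡ k ℕ.+ (m ℕ.+ r)
    reorder r = trans (ℕ.+-comm r (m ℕ.+ k)) (trans (cong (ℕ._+ r) (ℕ.+-comm m k)) (ℕ.+-assoc k m r))

  -- All pairs are compared at once, not just neighbours: zero is related to everything, so `⊵` is
  -- not transitive in general.
  family-⊵ : ∀ d {i j} → i ≤ j → j < size d → family d i ⊵ family d j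
  family-⊵ zero    _   _      = ⊵-refl 1ᵍ
  family-⊵ (suc d) {i} {j} i≤j j<n = subst₂ _⊵_
    (sym (family-mix d i {k} {m ℕ.+ r} refl k+m+r≡n))
    (sym (family-mix d j {k ℕ.+ m} {r} (sym k+m≡l) (trans (ℕ.+-assoc k m r) k+m+r≡n)))
    (mix-⊵ k m r (family d) λ {_} {j} i≤j j<n → family-⊵ d i≤j (subst (j <_) k+m+r≡n j<n))
    where
    k l m r : ℕ
    k = skip (suc d) i
    l = skip (suc d) j
    m = l ℕ.∸ k
    r = size d ℕ.∸ l
    k+m≡l : k ℕ.+ m ≡ l
    k+m≡l = ℕ.m+[n∸m]≡n (skip-mono (suc d) i≤j)
    l≤n : l ≤ size d
    -- The last index of level `d + 1` is `suc d + suc (suc d)`, which `skip` sends to `size d`.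
    l≤n = subst (l ≤_) (skip-> (suc d) (suc d)) (skip-mono (suc d) (ℕ.≤-pred j<n))
    k+m+r≡n : k ℕ.+ (m ℕ.+ r) ≡ size d
    k+m+r≡n = trans (sym (ℕ.+-assoc k m r)) (trans (cong (ℕ._+ r) k+m≡l) (ℕ.m+[n∸m]≡n l≤n))

  -- Multiplication by the conjugate of `1 - z` reduces this to cancelling `|1 - z|²`, which is
  -- positive because `y` is nonzero.
  1-z-cancelˡ : y ≢ 0ℚ → ∀ {a b} → 1-z *ᵍ a ≡ 1-z *ᵍ b → a ≡ b
  1-z-cancelˡ y≢0 {a} {b} eq = cong₂ _,_
    (*-cancelˡ-pos 0<norm (trans (sym (re-part a)) (trans (cong (λ v → (1ℚ ℚ.- x) ℚ.* proj₁ v ℚ.- y ℚ.* proj₂ v) eq) (re-part b))))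
    (*-cancelˡ-pos 0<norm (trans (sym (im-part a)) (trans (cong (λ v → (1ℚ ℚ.- x) ℚ.* proj₂ v ℚ.+ y ℚ.* proj₁ v) eq) (im-part b))))
    where
    0<norm : 0ℚ ℚ.< (1ℚ ℚ.- x) ℚ.* (1ℚ ℚ.- x) ℚ.+ y ℚ.* y
    0<norm = ℚ.+-mono-≤-< (0≤p*p (1ℚ ℚ.- x)) (0<p*p y≢0)
    re-part : ∀ a → (1ℚ ℚ.- x) ℚ.* proj₁ (1-z *ᵍ a) ℚ.- y ℚ.* proj₂ (1-z *ᵍ a)
            ≡ ((1ℚ ℚ.- x) ℚ.* (1ℚ ℚ.- x) ℚ.+ y ℚ.* y) ℚ.* proj₁ a
    re-part (a , b) = solve 4 (λ w y a b → w :* (w :* a :- :- y :* b) :- y :* (w :* b :+ :- y :* a)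
                                        := (w :* w :+ y :* y) :* a) refl (1ℚ ℚ.- x) y a b
    im-part : ∀ a → (1ℚ ℚ.- x) ℚ.* proj₂ (1-z *ᵍ a) ℚ.+ y ℚ.* proj₁ (1-z *ᵍ a)
            ≡ ((1ℚ ℚ.- x) ℚ.* (1ℚ ℚ.- x) ℚ.+ y ℚ.* y) ℚ.* proj₂ a
    im-part (a , b) = solve 4 (λ w y a b → w :* (w :* b :+ :- y :* a) :+ y :* (w :* a :- :- y :* b)
                                        := (w :* w :+ y :* y) :* b) refl (1ℚ ℚ.- x) y a b

  -- |h|² = |h - i y b|² + 2 y Im(h b̄) - y² |b|²
  norm-cross : ∀ h b → y ℚ.* y ℚ.* norm b ℚ.≤ cross h b → y ℚ.* y ℚ.* norm b ℚ.≤ norm h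
  norm-cross h@(h₁ , h₂) b@(b₁ , b₂) le = begin
    s                                                ≡⟨ solve 1 (λ s → s := con 0ℚ :+ (s :+ s :- s)) refl s ⟩
    0ℚ ℚ.+ (s ℚ.+ s ℚ.- s)                           ≤⟨ ℚ.+-mono-≤ (0≤+ (0≤p*p p) (0≤p*p q)) (ℚ.+-monoˡ-≤ (ℚ.- s) (ℚ.+-mono-≤ le le)) ⟩
    p ℚ.* p ℚ.+ q ℚ.* q ℚ.+ (cross h b ℚ.+ cross h b ℚ.- s)
      ≡⟨ solve 5 (λ y h₁ h₂ b₁ b₂ →
           (h₁ :+ y :* b₂) :* (h₁ :+ y :* b₂) :+ (h₂ :- y :* b₁) :* (h₂ :- y :* b₁)
             :+ (y :* (h₂ :* b₁ :- h₁ :* b₂) :+ y :* (h₂ :* b₁ :- h₁ :* b₂) :- y :* y :* (b₁ :* b₁ :+ b₂ :* b₂))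
           := h₁ :* h₁ :+ h₂ :* h₂) refl y h₁ h₂ b₁ b₂ ⟩
    norm h ∎
    where
    open ℚ.≤-Reasoning
    s p q : ℚ
    s = y ℚ.* y ℚ.* norm b
    p = h₁ ℚ.+ y ℚ.* b₂
    q = h₂ ℚ.- y ℚ.* b₁

  0≤cross-ι : ∀ n a b → 0ℚ ℚ.≤ cross a b → 0ℚ ℚ.≤ cross (ι n *ᵍ a) b
  0≤cross-ι zero    a b p = subst (λ s → 0ℚ ℚ.≤ cross s b) (sym (zeroˡ a)) (proj₁ (0⊵ b))
  0≤cross-ι (suc n) a b p = subst (λ s → 0ℚ ℚ.≤ cross s b)
    (sym (trans (distribʳ a 1ᵍ (ι n)) (cong (_+ᵍ ι n *ᵍ a) (*-identityˡ a))))
    (0≤cross-+ˡ a (ι n *ᵍ a) b p (0≤cross-ι n a b p))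

  -- Against `b`, the summand `b` contributes 0, `z b` contributes exactly `y² |b|²`, and the
  -- multiple of `t` contributes nothing negative.
  norm-lower : ∀ n b t → 0ℚ ℚ.≤ cross t b → y ℚ.* y ℚ.* norm b ℚ.≤ norm ((1ᵍ +ᵍ z) *ᵍ b +ᵍ ι n *ᵍ t)
  norm-lower n b t 0≤tb = norm-cross ((1ᵍ +ᵍ z) *ᵍ b +ᵍ ι n *ᵍ t) b (begin
    s                                                 ≡⟨ solve 1 (λ s → s := con 0ℚ :+ s :+ con 0ℚ) refl s ⟩
    0ℚ ℚ.+ s ℚ.+ 0ℚ                                   ≤⟨ ℚ.+-monoʳ-≤ (0ℚ ℚ.+ s) (0≤cross-ι n t b 0≤tb) ⟩
    0ℚ ℚ.+ s ℚ.+ cross (ι n *ᵍ t) b                   ≡⟨ cong₂ (λ p q → p ℚ.+ q ℚ.+ cross (ι n *ᵍ t) b) (sym (cross-self b)) (sym (cross-z-self b)) ⟩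
    cross b b ℚ.+ cross (z *ᵍ b) b ℚ.+ cross (ι n *ᵍ t) b
      ≡⟨ cong (ℚ._+ cross (ι n *ᵍ t) b) (cross-+ˡ b (z *ᵍ b) b) ⟨
    cross (b +ᵍ z *ᵍ b) b ℚ.+ cross (ι n *ᵍ t) b
      ≡⟨ cross-+ˡ (b +ᵍ z *ᵍ b) (ι n *ᵍ t) b ⟨
    cross (b +ᵍ z *ᵍ b +ᵍ ι n *ᵍ t) b
      ≡⟨ cong (λ a → cross (a +ᵍ ι n *ᵍ t) b) (trans (distribʳ b 1ᵍ z) (cong (_+ᵍ z *ᵍ b) (*-identityˡ b))) ⟨
    cross ((1ᵍ +ᵍ z) *ᵍ b +ᵍ ι n *ᵍ t) b ∎)
    where
    open ℚ.≤-Reasoning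
    s : ℚ
    s = y ℚ.* y ℚ.* norm b

  module _ (y≢0 : y ≢ 0ℚ) where

    private
      cancel : ∀ {a b} → 1-z *ᵍ a ≡ 1-z *ᵍ b → a ≡ b
      cancel = 1-z-cancelˡ y≢0

    -- The two sums in `side` call for the two components of `⊵`: a member before index `d` is
    -- compared with `eulerian d` directly, a member after it once multiplied by `z`.
    0≤cross-side : ∀ d → 0ℚ ℚ.≤ cross (side d) (eulerian d)
    0≤cross-side d = subst (λ b → 0ℚ ℚ.≤ cross (side d) b) (eulerian-low +ᵍ-cancelˡ cancel d)
      (0≤cross-+ˡ (sumTo d (family d)) (z *ᵍ sumTo d (λ i → family d (i ℕ.+ suc (suc d)))) (family d d)
        (proj₁ (sumTo-⊵ d λ i<d → family-⊵ d (ℕ.<⇒≤ i<d) (s≤s (ℕ.m≤m+n d (suc d)))))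
        (proj₂ (⊵-sumTo d {a = family d d} λ {i} i<d → family-⊵ d
          (ℕ.≤-trans (ℕ.m≤n+m d (i ℕ.+ 2)) (ℕ.≤-reflexive (trans (ℕ.+-assoc i 2 d) refl)))
          (s≤s (ℕ.≤-trans (ℕ.≤-reflexive (ℕ.+-suc i (suc d))) (ℕ.+-monoˡ-≤ (suc d) i<d))))))

    norm-eulerian : ∀ d → (y ℚ.* y) ^ d ℚ.≤ norm (eulerian d)
    norm-eulerian zero    = ℚ.≤-refl
    norm-eulerian (suc d) = begin
      y ℚ.* y ℚ.* (y ℚ.* y) ^ d             ≤⟨ ℚ.*-monoˡ-≤-nonNeg (y ℚ.* y) {{ℚ.nonNegative (0≤p*p y)}} (norm-eulerian d) ⟩
      y ℚ.* y ℚ.* norm (eulerian d)         ≤⟨ norm-lower 1 (eulerian d) (side d) (0≤cross-side d) ⟩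
      norm ((1ᵍ +ᵍ z) *ᵍ eulerian d +ᵍ ι 1 *ᵍ side d)
        ≡⟨ cong norm (trans (cong ((1ᵍ +ᵍ z) *ᵍ eulerian d +ᵍ_) (*-identityˡ (side d))) (sym (eulerian-suc +ᵍ-cancelˡ cancel d))) ⟩
      norm (eulerian (suc d))               ∎
      where open ℚ.≤-Reasoning

    -- The induction over cappings is already spent in `h-polynomial-capped`. What remains is
    -- `norm-lower` with the multiple `ℓ + 1`, measured against the cube one dimension lower.
    norm-capped : ∀ {N d ℓ} {𝒫 : PolytopalComplex N} → CappedCubical d ℓ 𝒫 →
                  (y ℚ.* y) ^ d ℚ.≤ norm (hsum d (f-vector (sd 𝒫)))
    -- In dimension 0 only the empty chain is counted and both sides are 1.
    norm-capped {d = zero}  capped𝒫 = ℚ.≤-refl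
    norm-capped {d = suc d} {ℓ} {𝒫} capped𝒫 = begin
      y ℚ.* y ℚ.* (y ℚ.* y) ^ d             ≤⟨ ℚ.*-monoˡ-≤-nonNeg (y ℚ.* y) {{ℚ.nonNegative (0≤p*p y)}} (norm-eulerian d) ⟩
      y ℚ.* y ℚ.* norm (eulerian d)         ≤⟨ norm-lower (suc ℓ) (eulerian d) (side d) (0≤cross-side d) ⟩
      norm ((1ᵍ +ᵍ z) *ᵍ eulerian d +ᵍ ι (suc ℓ) *ᵍ side d)
        ≡⟨ cong norm (h-polynomial-capped +ᵍ-cancelˡ cancel capped𝒫) ⟨
      norm (hsum (suc d) (f-vector (sd 𝒫))) ∎
      where open ℚ.≤-Reasoning

-- From rational points to complex zeros.

/1-homo-+ : ∀ i j → (i ℤ.+ j) ℚ./ 1 ≡ i ℚ./ 1 ℚ.+ j ℚ./ 1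
/1-homo-+ i j = ℚ.toℚᵘ-injective (begin
  ℚ.toℚᵘ ((i ℤ.+ j) ℚ./ 1)                        ≈⟨ ℚ.toℚᵘ-fromℚᵘ (mkℚᵘ (i ℤ.+ j) 0) ⟩
  mkℚᵘ (i ℤ.+ j) 0                                ≈⟨ *≡* (cong (ℤ._* pos 1) (sym (cong₂ ℤ._+_ (ℤ.*-identityʳ i) (ℤ.*-identityʳ j)))) ⟩
  mkℚᵘ i 0 ℚᵘ.+ mkℚᵘ j 0                          ≈⟨ ℚᵘ.+-cong (ℚ.toℚᵘ-fromℚᵘ (mkℚᵘ i 0)) (ℚ.toℚᵘ-fromℚᵘ (mkℚᵘ j 0)) ⟨
  ℚ.toℚᵘ (i ℚ./ 1) ℚᵘ.+ ℚ.toℚᵘ (j ℚ./ 1)          ≈⟨ ℚ.toℚᵘ-homo-+ (i ℚ./ 1) (j ℚ./ 1) ⟨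
  ℚ.toℚᵘ (i ℚ./ 1 ℚ.+ j ℚ./ 1)                    ∎)
  where open ℚᵘ.≃-Reasoning

/1-homo-* : ∀ i j → (i ℤ.* j) ℚ./ 1 ≡ i ℚ./ 1 ℚ.* (j ℚ./ 1)
/1-homo-* i j = ℚ.toℚᵘ-injective (begin
  ℚ.toℚᵘ ((i ℤ.* j) ℚ./ 1)                        ≈⟨ ℚ.toℚᵘ-fromℚᵘ (mkℚᵘ (i ℤ.* j) 0) ⟩
  mkℚᵘ (i ℤ.* j) 0                                ≡⟨⟩
  mkℚᵘ i 0 ℚᵘ.* mkℚᵘ j 0                          ≈⟨ ℚᵘ.*-cong (ℚ.toℚᵘ-fromℚᵘ (mkℚᵘ i 0)) (ℚ.toℚᵘ-fromℚᵘ (mkℚᵘ j 0)) ⟨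
  ℚ.toℚᵘ (i ℚ./ 1) ℚᵘ.* ℚ.toℚᵘ (j ℚ./ 1)          ≈⟨ ℚ.toℚᵘ-homo-* (i ℚ./ 1) (j ℚ./ 1) ⟨
  ℚ.toℚᵘ (i ℚ./ 1 ℚ.* (j ℚ./ 1))                  ∎)
  where open ℚᵘ.≃-Reasoning

fromℤᵍ : ℤ → 𝔾
fromℤᵍ i = i ℚ./ 1 , 0ℚ

fromℤᵍ-* : ∀ i j → fromℤᵍ (i ℤ.* j) ≡ fromℤᵍ i *ᵍ fromℤᵍ j
fromℤᵍ-* i j = cong₂ _,_
  (trans (/1-homo-* i j) (sym (ℚ.+-identityʳ _)))
  (sym (cong₂ ℚ._+_ (ℚ.*-zeroʳ (i ℚ./ 1)) (ℚ.*-zeroˡ (j ℚ./ 1))))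

at : ℂ → ℕ → 𝔾
at z n = seq (re z) n , seq (im z) n

module At (x y : ℚ) where

  open Cone x y public
  open Interlacing 𝔾-isCommutativeSemiring z 1-z z+[1-z]≡1 public
  open Evaluation fromℤᵍ refl refl (λ i j → cong₂ _,_ (/1-homo-+ i j) refl) fromℤᵍ-* public

-- Holds exactly, with no error term, because the real operations act on the sequences term by term.
eval-at : ∀ p ζ n → at (eval (toRealPoly p) ζ) n ≡ At.evaluate (seq (re ζ) n) (seq (im ζ) n) p
eval-at []      ζ n = refl
eval-at (a ∷ p) ζ n = cong (λ e → fromℤᵍ a +ᵍ at ζ n *ᵍ e) (eval-at p ζ n)

p-0≡p : ∀ p → p ℚ.- 0ℚ ≡ p
p-0≡p = ℚ.+-identityʳ

∣p∣*∣p∣≡p*p : ∀ p → ℚ.∣ p ∣ ℚ.* ℚ.∣ p ∣ ≡ p ℚ.* p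
∣p∣*∣p∣≡p*p p = trans (sym (ℚ.∣p*q∣≡∣p∣*∣q∣ p p)) (ℚ.0≤p⇒∣p∣≡p (0≤p*p p))

0<^ : ∀ {p} d → 0ℚ ℚ.< p → 0ℚ ℚ.< p ^ d
0<^ zero    0<p = ℚ.positive⁻¹ 1ℚ
0<^ (suc d) 0<p = *-pos 0<p (0<^ d 0<p)

^-mono-≤ : ∀ d {p q} → 0ℚ ℚ.≤ p → p ℚ.≤ q → p ^ d ℚ.≤ q ^ d
^-mono-≤ zero    0≤p p≤q = ℚ.≤-refl
^-mono-≤ (suc d) {p} {q} 0≤p p≤q = ℚ.≤-trans
  (ℚ.*-monoˡ-≤-nonNeg p {{ℚ.nonNegative 0≤p}} (^-mono-≤ d 0≤p p≤q))
  (ℚ.*-monoʳ-≤-nonNeg (q ^ d) {{ℚ.nonNegative (0≤^ d)}} p≤q)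
  where
  0≤^ : ∀ d → 0ℚ ℚ.≤ q ^ d
  0≤^ zero    = ℚ.nonNegative⁻¹ 1ℚ
  0≤^ (suc d) = 0≤* (ℚ.≤-trans 0≤p p≤q) (0≤^ d)

-- The minimum with 1 avoids a square root: below 1, squaring does not increase the absolute value.
square-< : ∀ {p κ} → ℚ.∣ p ∣ ℚ.< ½ ℚ.* κ ℚ.⊓ 1ℚ → p ℚ.* p ℚ.< ½ ℚ.* κ
square-< {p} {κ} ∣p∣< = begin-strict
  p ℚ.* p               ≡⟨ ∣p∣*∣p∣≡p*p p ⟨
  ℚ.∣ p ∣ ℚ.* ℚ.∣ p ∣   ≤⟨ ℚ.*-monoʳ-≤-nonNeg ℚ.∣ p ∣ {{ℚ.∣-∣-nonNeg p}} (ℚ.≤-trans (ℚ.<⇒≤ ∣p∣<) (ℚ.p⊓q≤q (½ ℚ.* κ) 1ℚ)) ⟩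
  1ℚ ℚ.* ℚ.∣ p ∣        ≡⟨ ℚ.*-identityˡ ℚ.∣ p ∣ ⟩
  ℚ.∣ p ∣               <⟨ ∣p∣< ⟩
  ½ ℚ.* κ ℚ.⊓ 1ℚ        ≤⟨ ℚ.p⊓q≤p (½ ℚ.* κ) 1ℚ ⟩
  ½ ℚ.* κ               ∎
  where open ℚ.≤-Reasoning

0<⊓ : ∀ {p q} → 0ℚ ℚ.< p → 0ℚ ℚ.< q → 0ℚ ℚ.< p ℚ.⊓ q
0<⊓ {p} {q} 0<p 0<q with ℚ.⊓-sel p q
... | inj₁ eq = subst (0ℚ ℚ.<_) (sym eq) 0<p
... | inj₂ eq = subst (0ℚ ℚ.<_) (sym eq) 0<q

-- Order on `ℚ` is decidable, so each late index can be treated by contradiction: if `|y|` were at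
-- least `ε`, the norm would be at least `(ε²)^d`, but convergence to 0 has already made it smaller.
norm-bound⇒im≈0 : ∀ d {p : Poly ℝ} →
  (∀ z n → seq (im z) n ≢ 0ℚ → (seq (im z) n ℚ.* seq (im z) n) ^ d ℚ.≤ norm (at (eval p z) n)) →
  ∀ z → eval p z ≈ᶜ fromℝ 0ᵣ → im z ≈ 0ᵣ
norm-bound⇒im≈0 d {p} bound z (re≈0 , im≈0) ε 0<ε
  with re≈0 η 0<η | im≈0 η 0<η
  where
  η : ℚ
  -- Chosen so that the squares of the real and imaginary parts each stay below half of `(ε²)^d`.
  η = ½ ℚ.* ((ε ℚ.* ε) ^ d) ℚ.⊓ 1ℚ
  0<η : 0ℚ ℚ.< η
  0<η = 0<⊓ (*-pos (ℚ.positive⁻¹ ½) (0<^ d (*-pos 0<ε 0<ε))) (ℚ.positive⁻¹ 1ℚ)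
... | i , re< | j , im< = i ℕ.⊔ j , close
  where
  close : ∀ n → i ℕ.⊔ j ℕ.≤ n → ℚ.∣ seq (im z) n ℚ.- seq 0ᵣ n ∣ ℚ.< ε
  close n k≤n with ℚ.∣ seq (im z) n ℚ.- seq 0ᵣ n ∣ ℚ.<? ε
  ... | yes y<ε = y<ε
  ... | no y≮ε  = contradiction κ<κ (ℚ.<-irrefl refl)
    where
    open ℚ.≤-Reasoning
    y κ a b : ℚ
    y = seq (im z) n
    κ = (ε ℚ.* ε) ^ d
    a = seq (re (eval p z)) n
    b = seq (im (eval p z)) n
    ε≤∣y∣ : ε ℚ.≤ ℚ.∣ y ∣
    ε≤∣y∣ = subst (λ q → ε ℚ.≤ ℚ.∣ q ∣) (p-0≡p y) (ℚ.≮⇒≥ y≮ε)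
    y≢0 : y ≢ 0ℚ
    y≢0 y≡0 = ℚ.<-irrefl refl (ℚ.<-≤-trans 0<ε (subst (λ q → ε ℚ.≤ ℚ.∣ q ∣) y≡0 ε≤∣y∣))
    ε²≤y² : ε ℚ.* ε ℚ.≤ y ℚ.* y
    ε²≤y² = subst (ε ℚ.* ε ℚ.≤_) (∣p∣*∣p∣≡p*p y) (ℚ.≤-trans
      (ℚ.*-monoˡ-≤-nonNeg ε {{ℚ.nonNegative (ℚ.<⇒≤ 0<ε)}} ε≤∣y∣)
      (ℚ.*-monoʳ-≤-nonNeg ℚ.∣ y ∣ {{ℚ.∣-∣-nonNeg y}} ε≤∣y∣))
    a²< : a ℚ.* a ℚ.< ½ ℚ.* κ
    a²< = square-< {a} {κ} (subst (λ q → ℚ.∣ q ∣ ℚ.< ½ ℚ.* κ ℚ.⊓ 1ℚ) (p-0≡p a) (re< n (ℕ.m⊔n≤o⇒m≤o i j k≤n)))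
    b²< : b ℚ.* b ℚ.< ½ ℚ.* κ
    b²< = square-< {b} {κ} (subst (λ q → ℚ.∣ q ∣ ℚ.< ½ ℚ.* κ ℚ.⊓ 1ℚ) (p-0≡p b) (im< n (ℕ.m⊔n≤o⇒n≤o i j k≤n)))
    κ<κ : κ ℚ.< κ
    κ<κ = begin-strict
      κ                             ≤⟨ ^-mono-≤ d (0≤p*p ε) ε²≤y² ⟩
      (y ℚ.* y) ^ d                 ≤⟨ bound z n y≢0 ⟩
      a ℚ.* a ℚ.+ b ℚ.* b           <⟨ ℚ.+-mono-< a²< b²< ⟩
      ½ ℚ.* κ ℚ.+ ½ ℚ.* κ           ≡⟨ half+half κ ⟩
      κ                             ∎

corollary4p9 : ∀ (ℓ d N : ℕ) (𝒞 : PolytopalComplex N) →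
    CappedCubical d ℓ 𝒞 →
    RealRooted (toRealPoly (h d (f-vector (sd 𝒞))))
corollary4p9 ℓ d N 𝒞 capped𝒞 = inj₂ (norm-bound⇒im≈0 d {toRealPoly p} λ ζ n y≢0 →
  let x = seq (re ζ) n
      y = seq (im ζ) n
  in subst (λ e → (y ℚ.* y) ^ d ℚ.≤ norm e)
       (sym (trans (eval-at p ζ n) (At.evaluate-h x y d (f-vector (sd 𝒞)))))
       (At.norm-capped x y y≢0 capped𝒞))
  where
  p : Poly ℤ
  p = h d (f-vector (sd 𝒞))
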